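{- Let $m,n\in\mathbb{N}$ and let $a$ be an integer with $1\le a\le m+n-2$. Then the dual (with respect to $m,n$) of $T_a\cap R_{n,m}$ is $T_{m+n-1-a}\cap R_{n,m}$. Consequently, for $m=n$, $1\le a\le 2n-2$, and the family $\mathcal{F}=\{S_{i,j}\colon i,j\in\mathbb{Z}_+,\ i+j=a\}$ of double stars, $$\mathrm{ex}(n,n,\mathcal{F})=n^2-\gamma(T_{2n-1-a},n,n),$$ where, writing $k=2n-1-a$, $\gamma(T_k,n,n)$ equals $\frac{kn}{2}$ if $k$ is even; $\frac{k+1}{2}n-\frac{k-1}{2}$ if $k$ is odd and $k\le n$; and $\frac{k-1}{2}n+\left\lceil\frac{n(2n-k+1)}{2(2n-k)}\right\rceil$ if $k$ is odd and $k>n$.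
   Context: $\mathbb{Z}_+=\{0,1,2,\dots\}$, $\mathbb{N}=\{1,2,\dots\}$, $[0,c]=\{0,\dots,c\}$, $R_{a,b}=[0,a-1]\times[0,b-1]$. A zero-set (or Young diagram) is a downward-closed subset of $\mathbb{Z}_+^2$. For $a\in\mathbb{N}$, $T_a=\{(x,y)\in\mathbb{Z}_+^2\colon x+y\le a-1\}$. Young domination: the graph $K_m\Box K_n$ is represented on the vertex set $R_{n,m}=[0,n-1]\times[0,m-1]$, two vertices being adjacent iff they differ in exactly one coordinate. For $v=(j,i)\in R_{n,m}$, $\mathcal{N}^r(v)$ is the set of all $(j',i)\in R_{n,m}$ with $j'\ne j$ and $\mathcal{N}^c(v)$ the set of all $(j,i')\in R_{n,m}$ with $i'\neq i$. For a zero-set $\mathcal{Z}$, $\mathcal{T}(A)=A\cup\{v\in R_{n,m}\setminus A\colon (|\mathcal{N}^r(v)\cap A|,|\mathcal{N}^c(v)\cap A|)\notin\mathcal{Z}\}$ and $\gamma(\mathcal{Z},m,n)=\min\{|A|\colon A\subseteq R_{n,m},\ \mathcal{T}(A)=R_{n,m}\}$. Duality: a convex corner of a Young diagram $\mathcal{Y}$ is a maximal point of $\mathcal{Y}$ in the coordinatewise order; a concave corner is a minimal point of $\mathbb{Z}_+^2\setminus\mathcal{Y}$; $\mathcal{I}_{\mathcal{Y}}$ is the set of concave corners. For a Young diagram $\mathcal{Y}\subseteq R_{n,m}$, its dual is the unique Young diagram $\check{\mathcal{Y}}\subseteq R_{n,m}$ whose set of convex corners is $\{(n-a-1,m-b-1)\colon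 (a,b)\in\mathcal{I}_{\mathcal{Y}},\ 0\le a\le n-1,\ 0\le b\le m-1\}$. Double stars: for integers $p,q\ge0$, $S_{p,q}$ is obtained from disjoint $K_{1,p}$ and $K_{1,q}$ by adding an edge between the center $u$ of $K_{1,p}$ and the center $v$ of $K_{1,q}$ (so $u$ has degree $p+1$ and $v$ degree $q+1$); it is equipped with the bipartition $(X_{p,q},Y_{p,q})$ with $u\in X_{p,q}$, $v\in Y_{p,q}$. For a family $\mathcal{F}$ of double stars, $\mathrm{ex}(m,n,\mathcal{F})$ is the maximum number of edges in a bipartite graph with bipartition $(X,Y)$, $|X|=m$, $|Y|=n$, that contains no $S_{p,q}\in\mathcal{F}$ as a (not necessarily induced) subgraph respecting the bipartitions (with $X_{p,q}$ inside $X$ and $Y_{p,q}$ inside $Y$). -}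

module Defs where

open import Data.Bool using (Bool; true; false; not; _∧_; if_then_else_)
open import Data.Fin using (Fin; zero; suc)
open import Data.Fin.Properties using (_≟_)
open import Data.Nat using (ℕ; zero; suc; _+_; _*_; _∸_; _≤_; _<_; s≤s; NonZero)
open import Data.Nat.DivMod using (_/_)
open import Data.Nat.Properties
  using (≤-<-trans; +-mono-≤; m∸n≤m; m<n⇒0<n∸m; +-0-commutativeMonoid)
open import Data.Product using (∃-syntax; _×_; _,_)
open import Data.Product.Relation.Binary.Pointwise.NonDependent using (Pointwise)
open import Data.Sum using (_⊎_)
open import Function.Definitions using (Injective)
open import Level using (0ℓ)
open import Relation.Binary.PropositionalEquality using (_≡_)
open import Relation.Nullary using (¬_; does)
open import Relation.Unary using (Pred; _∈_; _∉_; _⊆_; _≐_)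
open import Algebra.Properties.CommutativeMonoid.Sum +-0-commutativeMonoid using (sum)

IsMinimum : Pred ℕ 0ℓ → ℕ → Set
IsMinimum P k = k ∈ P × (∀ j → j ∈ P → k ≤ j)

IsMaximum : Pred ℕ 0ℓ → ℕ → Set
IsMaximum P k = k ∈ P × (∀ j → j ∈ P → j ≤ k)

⌈_/_⌉ : ℕ → (d : ℕ) .{{_ : NonZero d}} → ℕ
⌈ p / d ⌉ = (p + (d ∸ 1)) / d

infix 4 _⊑_
_⊑_ : ℕ × ℕ → ℕ × ℕ → Set
_⊑_ = Pointwise _≤_ _≤_

record ZeroSet : Set₁ where
  field
    pts    : Pred (ℕ × ℕ) 0ℓ
    closed : ∀ {p q} → p ⊑ q → q ∈ pts → p ∈ pts

open ZeroSet public

R : ℕ → ℕ → ZeroSet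
R a b .pts (x , y) = x < a × y < b
R a b .closed (x≤ , y≤) (x< , y<) = ≤-<-trans x≤ x< , ≤-<-trans y≤ y<

-- x + y < a is x + y ≤ a - 1 without truncated subtraction.
T : ℕ → ZeroSet
T a .pts (x , y) = x + y < a
T a .closed (x≤ , y≤) q = ≤-<-trans (+-mono-≤ x≤ y≤) q

infixr 7 _⊓_
_⊓_ : ZeroSet → ZeroSet → ZeroSet
(Y ⊓ Z) .pts p = p ∈ pts Y × p ∈ pts Z
(Y ⊓ Z) .closed le (y , z) = closed Y le y , closed Z le z

ConvexCorner : ZeroSet → Pred (ℕ × ℕ) 0ℓ
ConvexCorner Y p = p ∈ pts Y × (∀ q → q ∈ pts Y → p ⊑ q → q ≡ p)

ConcaveCorner : ZeroSet → Pred (ℕ × ℕ) 0ℓ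
ConcaveCorner Y p = p ∉ pts Y × (∀ q → q ∉ pts Y → q ⊑ p → q ≡ p)

-- The truncated subtractions are exact, since a < n and b < m.
ReflectedCorner : ℕ → ℕ → ZeroSet → Pred (ℕ × ℕ) 0ℓ
ReflectedCorner m n Y c =
  ∃[ a ] ∃[ b ] (a , b) ∈ ConcaveCorner Y × a < n × b < m
                × c ≡ (n ∸ a ∸ 1 , m ∸ b ∸ 1)

-- The dual of Y is taken inside R n m: first coordinates below n, second below m.
record IsDual (m n : ℕ) (Y D : ZeroSet) : Set where
  field
    Y⊆R     : pts Y ⊆ pts (R n m)
    D⊆R     : pts D ⊆ pts (R n m)
    corners : ConvexCorner D ≐ ReflectedCorner m n Y

-- A vertex set of K_m □ K_n, drawn on [0,n-1] × [0,m-1]; also the edge set of a bipartite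
-- graph whose parts have sizes n and m.
Grid : ℕ → ℕ → Set
Grid n m = Fin n × Fin m → Bool

∣_∣ : ∀ {n m} → Grid n m → ℕ
∣ A ∣ = sum λ j → sum λ i → if A (j , i) then 1 else 0

infixr 7 _∩_
_∩_ : ∀ {n m} → Grid n m → Grid n m → Grid n m
(A ∩ B) v = A v ∧ B v

Nʳ Nᶜ : ∀ {n m} → Fin n × Fin m → Grid n m
Nʳ (j , i) (j′ , i′) = not (does (j′ ≟ j)) ∧ does (i′ ≟ i)
Nᶜ (j , i) (j′ , i′) = does (j′ ≟ j) ∧ not (does (i′ ≟ i))

𝒯 : ∀ {n m} → ZeroSet → Grid n m → Pred (Fin n × Fin m) 0ℓ
𝒯 Z A v =
  A v ≡ true ⊎
  (A v ≡ false × (∣ Nʳ v ∩ A ∣ , ∣ Nᶜ v ∩ A ∣) ∉ pts Z)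

-- "γ(Z,m,n) = g".
Isγ : ZeroSet → ℕ → ℕ → ℕ → Set
Isγ Z m n = IsMinimum λ g → ∃[ A ] (∀ (v : Fin n × Fin m) → v ∈ 𝒯 Z A) × ∣ A ∣ ≡ g

BipGraph : ℕ → ℕ → Set
BipGraph = Grid

-- In the first part, zero is u and the others are the q leaves of v; in the
-- second part, zero is v and the others are the p leaves of u.
S : (p q : ℕ) → BipGraph (suc q) (suc p)
S p q (zero  , _)     = true
S p q (suc _ , zero)  = true
S p q (suc _ , suc _) = false

Contains : ∀ {m n m′ n′} → BipGraph m n → BipGraph m′ n′ → Set
Contains {m} {n} {m′} {n′} G H =
  ∃[ f ] ∃[ g ] Injective {A = Fin m′} {B = Fin m} _≡_ _≡_ f
              × Injective {A = Fin n′} {B = Fin n} _≡_ _≡_ g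
              × (∀ x y → H (x , y) ≡ true → G (f x , g y) ≡ true)

-- "ex(m,n,F) = e", where (p , q) ∈ F stands for S p q belonging to the family.
IsEx : ℕ → ℕ → Pred (ℕ × ℕ) 0ℓ → ℕ → Set
IsEx m n F = IsMaximum λ e →
  ∃[ G ] (∀ p q → (p , q) ∈ F → ¬ Contains {m} {n} G (S p q)) × ∣ G ∣ ≡ e

StarsOfSize : ℕ → Pred (ℕ × ℕ) 0ℓ
StarsOfSize a (i , j) = i + j ≡ a

k<2n⇒nonZero : ∀ {k n} → k < 2 * n → NonZero (2 * (2 * n ∸ k))
k<2n⇒nonZero {k} {n} k<2n with 2 * n ∸ k | m<n⇒0<n∸m k<2n
... | suc _ | _ = _

2n∸1∸a<2n : ∀ n .{{_ : NonZero n}} a → 2 * n ∸ 1 ∸ a < 2 * n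
2n∸1∸a<2n (suc n) a = s≤s (m∸n≤m _ a)

{-# OPTIONS --safe #-}

-- The corners of T a inside the rectangle lie on the antidiagonal x + y = a or x + y = a − 1
-- (concave or convex), and the reflection maps x + y = a to x + y = m + n − 2 − a.
--
-- For the second part, both extremal problems are the same problem about degrees. A set A
-- dominates for T k iff along each edge of its complement H the degree sum is at most
-- D = 2n − k = a + 1, and H contains no double star S i j with i + j = a iff the same holds.
-- So the task is to maximise the number E of edges of H.
--
-- Upper bounds. Summing the degree sums over the edges gives Σ x² + Σ y² ≤ D E over the row
-- degrees x and the column degrees y. With x² ≥ 2hx − h² for D = 2h, and
-- x² ≥ (2h + 1)x − h(h + 1) for D = 2h + 1, this gives E ≤ nh and E ≤ nh + ⌊nh/(2h + 1)⌋.
-- When D = 2h + 1 ≥ n, look instead at a vertex of maximal degree d > h: its neighbours have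
-- degree at most D − d, the others at most d, and d(D − d) + (n − d)d ≤ (n − 1)(h + 1).
--
-- All three bounds are attained by graphs with σ vertices of degree h + 1 on each side, not
-- adjacent to those on the other side, and all other degrees equal to h, where σ is
-- 0, ⌊nh/(2h + 1)⌋ and n − h − 1 respectively.

module Submission where

open import Defs
open import Data.Bool using (Bool; true; false; not; _∧_; if_then_else_)
open import Data.Bool.Properties using (not-involutive)
open import Data.Fin using (Fin; zero; suc; toℕ; punchIn; punchOut; splitAt)
open import Data.Fin.Properties
  using (_≟_; toℕ<n; punchInᵢ≢i; punchIn-injective; punchIn-punchOut; punchOut-injective)
  renaming (suc-injective to Fin-suc-injective)
open import Data.Nat
  using (ℕ; zero; suc; _+_; _*_; _∸_; _≤_; _<_; z≤n; s≤s; s≤s⁻¹; _<?_; _≤?_; NonZero)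
open import Data.Nat.Divisibility using (_∣_; _∤_; ∣-refl; divides; n∣m*n)
open import Data.Nat.DivMod
open import Data.Nat.Properties hiding (_≟_)
open import Algebra.Properties.CommutativeMonoid.Sum +-0-commutativeMonoid
  using (sum; sum-cong-≗; sum-remove; ∑-distrib-+; ∑-comm)
open import Algebra.Properties.Semiring.Sum +-*-semiring using (*-distribʳ-sum)
open import Data.Nat.Tactic.RingSolver using (solve-∀)
open import Data.Product using (_×_; _,_; proj₁; proj₂; ∃-syntax; swap)
open import Data.Sum using (_⊎_; inj₁; inj₂; [_,_]′)
import Data.Sum as Sum
open import Function.Base using (_∘_; const; id)
open import Function.Bundles using (_⇔_; mk⇔)
open import Function.Definitions using (Injective)
open import Relation.Binary.PropositionalEquality
open import Relation.Nullary using (¬_; Dec; yes; no; does; contradiction)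
open import Relation.Nullary.Decidable using (dec-true; dec-false)
open import Relation.Unary using (_∈_; _∉_; _⊆_; _≐_)

-- Duality

-- If each coordinate grows weakly and the sum does not grow, neither coordinate can grow strictly.
⊑-antichain : ∀ {x y x′ y′} → (x , y) ⊑ (x′ , y′) → x′ + y′ ≤ x + y → (x , y) ≡ (x′ , y′)
⊑-antichain {x} {y} {x′} {y′} (x≤ , y≤) sum≤ = cong₂ _,_
  (≤-antisym x≤ (+-cancelʳ-≤ y x′ x (≤-trans (+-monoʳ-≤ x′ y≤) sum≤)))
  (≤-antisym y≤ (+-cancelˡ-≤ x y′ y (≤-trans (+-monoˡ-≤ y′ x≤) sum≤)))

-- If the sum exceeds `a`, some coordinate is positive and can be lowered by one without entering
-- `T a`, against minimality.
concaveCorner⇒sum≡ : ∀ {a n m x y} → 1 ≤ a → x < n → y < m →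
                     (x , y) ∈ ConcaveCorner (T a ⊓ R n m) → x + y ≡ a
concaveCorner⇒sum≡ {a} {n} {m} {x} {y} 1≤a x<n y<m (∉Y , minimal) =
  ≤-antisym (≮⇒≥ (not-above x y x<n y<m minimal)) (≮⇒≥ λ sum<a → ∉Y (sum<a , x<n , y<m))
  where
  not-above : ∀ x y → x < n → y < m →
              (∀ q → q ∉ pts (T a ⊓ R n m) → q ⊑ (x , y) → q ≡ (x , y)) → ¬ a < x + y
  not-above zero    zero    _ _ _  ()
  not-above zero    (suc y) _ _ min (s≤s a≤y)
    with min (0 , y) (λ (y<a , _) → <⇒≱ y<a a≤y) (z≤n , n≤1+n y)
  ... | ()
  not-above (suc x) y       _ _ min (s≤s a≤x+y)
    with min (x , y) (λ (x+y<a , _) → <⇒≱ x+y<a a≤x+y) (n≤1+n x , ≤-refl)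
  ... | ()

sum≡⇒concaveCorner : ∀ {a n m x y} → x < n → y < m → x + y ≡ a →
                     (x , y) ∈ ConcaveCorner (T a ⊓ R n m)
sum≡⇒concaveCorner {a} x<n y<m refl =
  (λ (sum<a , _) → <-irrefl refl sum<a) ,
  λ q q∉ q⊑ → ⊑-antichain q⊑
    (≮⇒≥ λ sum<a → q∉ (sum<a , ≤-<-trans (proj₁ q⊑) x<n , ≤-<-trans (proj₂ q⊑) y<m))

reflect-+ : ∀ {n x} → x < n → (n ∸ x ∸ 1) + suc x ≡ n
reflect-+ {n} {x} x<n = begin
  (n ∸ x ∸ 1) + suc x  ≡⟨ cong (_+ suc x) (∸-+-assoc n x 1) ⟩
  (n ∸ (x + 1)) + suc x ≡⟨ cong (λ z → (n ∸ z) + suc x) (+-comm x 1) ⟩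
  (n ∸ suc x) + suc x  ≡⟨ m∸n+n≡m x<n ⟩
  n                    ∎
  where open ≡-Reasoning

reflect-< : ∀ {n x} → x < n → n ∸ x ∸ 1 < n
reflect-< {n} {x} x<n = begin-strict
  n ∸ x ∸ 1           <⟨ m<m+n _ (s≤s z≤n) ⟩
  (n ∸ x ∸ 1) + suc x ≡⟨ reflect-+ x<n ⟩
  n                   ∎
  where open ≤-Reasoning

reflect-involutive : ∀ {n x} → x < n → n ∸ (n ∸ x ∸ 1) ∸ 1 ≡ x
reflect-involutive {n} {x} x<n = +-cancelʳ-≡ (suc (n ∸ x ∸ 1)) _ _ (begin
  (n ∸ (n ∸ x ∸ 1) ∸ 1) + suc (n ∸ x ∸ 1) ≡⟨ reflect-+ (reflect-< x<n) ⟩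
  n                                        ≡⟨ reflect-+ x<n ⟨
  (n ∸ x ∸ 1) + suc x                      ≡⟨ rearrange (n ∸ x ∸ 1) x ⟩
  x + suc (n ∸ x ∸ 1)                      ∎)
  where
  open ≡-Reasoning
  rearrange : ∀ u v → u + suc v ≡ v + suc u
  rearrange = solve-∀

-- The additive form of the reflected sum being m + n - 2 - (x + y), arranged so that terms can be
-- cancelled later.
reflect-sum : ∀ {m n x y} → x < n → y < m →
              (n ∸ x ∸ 1) + (m ∸ y ∸ 1) + 1 + (x + y + 1) ≡ m + n
reflect-sum {m} {n} {x} {y} x<n y<m = begin
  (n ∸ x ∸ 1) + (m ∸ y ∸ 1) + 1 + (x + y + 1)    ≡⟨ rearrange (n ∸ x ∸ 1) (m ∸ y ∸ 1) x y ⟩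
  ((m ∸ y ∸ 1) + suc y) + ((n ∸ x ∸ 1) + suc x)  ≡⟨ cong₂ _+_ (reflect-+ y<m) (reflect-+ x<n) ⟩
  m + n                                          ∎
  where
  open ≡-Reasoning
  rearrange : ∀ x′ y′ x y → x′ + y′ + 1 + (x + y + 1) ≡ (y′ + suc y) + (x′ + suc x)
  rearrange = solve-∀

reflect-sum-a : ∀ {m n a b x y} → a + b + 1 ≡ m + n → x < n → y < m → x + y ≡ a →
                (n ∸ x ∸ 1) + (m ∸ y ∸ 1) + 1 ≡ b
reflect-sum-a {b = b} {x} {y} a+b+1≡m+n x<n y<m refl = +-cancelʳ-≡ (x + y + 1) _ _
  (trans (reflect-sum x<n y<m) (trans (sym a+b+1≡m+n) (rearrange (x + y) b)))
  where
  rearrange : ∀ a b → a + b + 1 ≡ b + (a + 1)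
  rearrange = solve-∀

reflect-sum-b : ∀ {m n a b x y} → a + b + 1 ≡ m + n → x < n → y < m → x + y + 1 ≡ b →
                (n ∸ x ∸ 1) + (m ∸ y ∸ 1) ≡ a
reflect-sum-b {a = a} {x = x} {y} a+b+1≡m+n x<n y<m refl = +-cancelʳ-≡ 1 _ _
  (+-cancelʳ-≡ (x + y + 1) _ _
    (trans (reflect-sum x<n y<m) (trans (sym a+b+1≡m+n) (rearrange a (x + y + 1)))))
  where
  rearrange : ∀ a b → a + b + 1 ≡ a + 1 + b
  rearrange = solve-∀

module _ {m n a b : ℕ} (1≤a : 1 ≤ a) (1≤b : 1 ≤ b) (a+b+1≡m+n : a + b + 1 ≡ m + n) where

  -- Here `b` is m + n - 1 - a. This set mediates the comparison: it consists of the reflected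
  -- concave corners of `T a ⊓ R n m`, and also of the convex corners of `T b ⊓ R n m`.
  Antidiagonal : ℕ × ℕ → Set
  Antidiagonal (x , y) = x < n × y < m × x + y + 1 ≡ b

  reflectedCorner⇒antidiagonal : ReflectedCorner m n (T a ⊓ R n m) ⊆ Antidiagonal
  reflectedCorner⇒antidiagonal (x , y , corner , x<n , y<m , refl) =
    reflect-< x<n , reflect-< y<m ,
    reflect-sum-a a+b+1≡m+n x<n y<m (concaveCorner⇒sum≡ 1≤a x<n y<m corner)

  antidiagonal⇒reflectedCorner : Antidiagonal ⊆ ReflectedCorner m n (T a ⊓ R n m)
  antidiagonal⇒reflectedCorner {x , y} (x<n , y<m , sum≡) =
    n ∸ x ∸ 1 , m ∸ y ∸ 1 ,
    sum≡⇒concaveCorner (reflect-< x<n) (reflect-< y<m) (reflect-sum-b a+b+1≡m+n x<n y<m sum≡) ,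
    reflect-< x<n , reflect-< y<m ,
    sym (cong₂ _,_ (reflect-involutive x<n) (reflect-involutive y<m))

  -- Induction on the deficit `d`: increase whichever coordinate still has room in the rectangle.
  raise : ∀ d x y → x < n → y < m → x + y + 1 + d ≡ b → ∃[ c ] (x , y) ⊑ c × Antidiagonal c
  raise zero x y x<n y<m eq =
    (x , y) , (≤-refl , ≤-refl) , x<n , y<m , trans (sym (+-identityʳ _)) eq
  raise (suc d) x y x<n y<m eq with suc x <? n | suc y <? m
  ... | yes 1+x<n | _ =
    let c , (x≤ , y≤) , c∈ = raise d (suc x) y 1+x<n y<m (trans (rearrange x y d) eq)
    in c , (≤-trans (n≤1+n x) x≤ , y≤) , c∈
    where
    rearrange : ∀ x y d → suc x + y + 1 + d ≡ x + y + 1 + suc d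
    rearrange = solve-∀
  ... | no _ | yes 1+y<m =
    let c , (x≤ , y≤) , c∈ = raise d x (suc y) x<n 1+y<m (trans (rearrange x y d) eq)
    in c , (x≤ , ≤-trans (n≤1+n y) y≤) , c∈
    where
    rearrange : ∀ x y d → x + suc y + 1 + d ≡ x + y + 1 + suc d
    rearrange = solve-∀
  -- No room is left only at the corner (n - 1, m - 1), whose sum plus one is m + n - 1 = a + b, so
  -- there is no deficit.
  ... | no 1+x≮n | no 1+y≮m = contradiction (begin-strict
      m + n                 ≤⟨ +-mono-≤ (≮⇒≥ 1+y≮m) (≮⇒≥ 1+x≮n) ⟩
      suc y + suc x         <⟨ m<m+n _ {suc d} (s≤s z≤n) ⟩
      suc y + suc x + suc d ≡⟨ rearrange y x d ⟩
      x + y + 1 + suc d + 1 ≡⟨ cong (_+ 1) eq ⟩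
      b + 1                 ≤⟨ +-monoˡ-≤ 1 (m≤n+m b a) ⟩
      a + b + 1             ≡⟨ a+b+1≡m+n ⟩
      m + n ∎) (<-irrefl refl)
    where
    open ≤-Reasoning
    rearrange : ∀ y x d → suc y + suc x + suc d ≡ x + y + 1 + suc d + 1
    rearrange = solve-∀

  -- Induction on the excess `d`. Only the origin cannot descend, and it has no excess because b ≥
  -- 1.
  lower : ∀ d x y → x < n → y < m → x + y + 1 ≡ b + d → ∃[ c ] c ⊑ (x , y) × Antidiagonal c
  lower zero x y x<n y<m eq = (x , y) , (≤-refl , ≤-refl) , x<n , y<m , trans eq (+-identityʳ b)
  lower (suc d) zero zero _ _ eq =
    contradiction (≤-trans (+-mono-≤ 1≤b (s≤s z≤n)) (≤-reflexive (sym eq))) λ { (s≤s ()) }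
  lower (suc d) zero (suc y) 0<n 1+y<m eq =
    let c , (x≤ , y≤) , c∈ = lower d zero y 0<n (<-trans (n<1+n y) 1+y<m)
                               (suc-injective (trans eq (+-suc b d)))
    in c , (x≤ , ≤-trans y≤ (n≤1+n y)) , c∈
  lower (suc d) (suc x) y 1+x<n y<m eq =
    let c , (x≤ , y≤) , c∈ = lower d x y (<-trans (n<1+n x) 1+x<n) y<m
                               (suc-injective (trans eq (+-suc b d)))
    in c , (≤-trans x≤ (n≤1+n x) , y≤) , c∈

  module _ (D : ZeroSet) where

    dual⇒triangle : IsDual m n (T a ⊓ R n m) D → pts D ≐ pts (T b ⊓ R n m)
    dual⇒triangle dual = D⊆ , ⊆D
      where
      open IsDual dual

      corner : Antidiagonal ⊆ ConvexCorner D
      corner c∈ = proj₂ corners (antidiagonal⇒reflectedCorner c∈)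

      D⊆ : pts D ⊆ pts (T b ⊓ R n m)
      D⊆ {x , y} p∈D with x + y <? b
      ... | yes sum<b = sum<b , D⊆R p∈D
      ... | no  sum≮b
        -- Since x + y + 1 = b + (d + 1), the point lies properly above an antidiagonal point, which
        -- is a convex corner of `D`. Maximality would make the two equal.
        with d , eq ← m≤n⇒∃[o]m+o≡n (≮⇒≥ sum≮b)
        with c , c⊑p , c∈@(_ , _ , sum-c) ← lower (suc d) x y (proj₁ (D⊆R p∈D)) (proj₂ (D⊆R p∈D))
               (trans (+-comm (x + y) 1) (trans (cong suc (sym eq)) (sym (+-suc b d))))
        with refl ← proj₂ (corner c∈) (x , y) p∈D c⊑p
        = contradiction (≤-reflexive (trans (+-comm 1 (x + y)) sum-c)) sum≮b

      ⊆D : pts (T b ⊓ R n m) ⊆ pts D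
      ⊆D {x , y} (sum<b , x<n , y<m)
        with d , eq ← m≤n⇒∃[o]m+o≡n sum<b
        with c , p⊑c , c∈ ← raise d x y x<n y<m (trans (cong (_+ d) (+-comm (x + y) 1)) eq)
        = closed D p⊑c (proj₁ (corner c∈))

    triangle⇒dual : pts D ≐ pts (T b ⊓ R n m) → IsDual m n (T a ⊓ R n m) D
    triangle⇒dual (D⊆ , ⊆D) = record
      { Y⊆R     = proj₂
      ; D⊆R     = λ p∈D → proj₂ (D⊆ p∈D)
      ; corners = antidiagonal⇒reflectedCorner ∘ convex⇒antidiagonal
                , antidiagonal⇒convex ∘ reflectedCorner⇒antidiagonal
      }
      where
      convex⇒antidiagonal : ConvexCorner D ⊆ Antidiagonal
      convex⇒antidiagonal {x , y} (p∈D , maximal)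
        with sum<b , x<n , y<m ← D⊆ p∈D
        with d , eq ← m≤n⇒∃[o]m+o≡n sum<b
        with c , p⊑c , c∈@(c₁<n , c₂<m , sum-c) ← raise d x y x<n y<m
               (trans (cong (_+ d) (+-comm (x + y) 1)) eq)
        with refl ← maximal c (⊆D (≤-reflexive (trans (+-comm 1 _) sum-c) , c₁<n , c₂<m)) p⊑c
        = c∈

      antidiagonal⇒convex : Antidiagonal ⊆ ConvexCorner D
      antidiagonal⇒convex {x , y} (x<n , y<m , sum≡) =
        ⊆D (≤-reflexive (trans (+-comm 1 _) sum≡) , x<n , y<m) ,
        λ q q∈D p⊑q → sym (⊑-antichain p⊑q
          (s≤s⁻¹ (≤-trans (proj₁ (D⊆ q∈D)) (≤-reflexive (trans (sym sum≡) (+-comm (x + y) 1))))))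

  dual⇔triangle : ∀ D → IsDual m n (T a ⊓ R n m) D ⇔ (pts D ≐ pts (T b ⊓ R n m))
  dual⇔triangle D = mk⇔ (dual⇒triangle D) (triangle⇒dual D)

-- Sums and counting over Fin n

sum-mono : ∀ {n} {f g : Fin n → ℕ} → (∀ i → f i ≤ g i) → sum f ≤ sum g
sum-mono {zero}  f≤g = z≤n
sum-mono {suc n} f≤g = +-mono-≤ (f≤g zero) (sum-mono (f≤g ∘ suc))

sum-const : ∀ n c → sum {n} (const c) ≡ n * c
sum-const zero    c = refl
sum-const (suc n) c = cong (c +_) (sum-const n c)

sum-zero : ∀ {n} {f : Fin n → ℕ} → (∀ i → f i ≡ 0) → sum f ≡ 0
sum-zero {n} f≡0 = trans (sum-cong-≗ f≡0) (trans (sum-const n 0) (*-zeroʳ n))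

sum-single : ∀ {n} {f : Fin n → ℕ} i → (∀ j → j ≢ i → f j ≡ 0) → sum f ≡ f i
sum-single {suc n} {f} i f≡0 = begin
  sum f                        ≡⟨ sum-remove {i = i} f ⟩
  f i + sum (f ∘ punchIn i)    ≡⟨ cong (f i +_) (sum-zero λ j → f≡0 _ (punchInᵢ≢i i j)) ⟩
  f i + 0                      ≡⟨ +-identityʳ (f i) ⟩
  f i                          ∎
  where open ≡-Reasoning

sum-splitAt : ∀ m {n} (f : Fin m ⊎ Fin n → ℕ) →
              sum (f ∘ splitAt m) ≡ sum (f ∘ inj₁) + sum (f ∘ inj₂)
sum-splitAt zero    f = refl
sum-splitAt (suc m) f = trans (cong (f (inj₁ zero) +_) (sum-splitAt m (f ∘ Sum.map suc id)))
  (sym (+-assoc (f (inj₁ zero)) _ _))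

-- Moving a window of length `n` by one place loses the first value and gains the next one; this
-- drives the induction in `hermite-identity`.
sum-shift : ∀ n (f : ℕ → ℕ) → sum {n} (λ i → f (suc (toℕ i))) + f 0 ≡ sum {n} (f ∘ toℕ) + f n
sum-shift zero    f = refl
sum-shift (suc n) f = begin
  f 1 + s₂ + f 0     ≡⟨ rearrange (f 1) s₂ (f 0) ⟩
  f 0 + (s₂ + f 1)   ≡⟨ cong (f 0 +_) (sum-shift n (f ∘ suc)) ⟩
  f 0 + (s₁ + f (suc n)) ≡⟨ +-assoc (f 0) s₁ _ ⟨
  f 0 + s₁ + f (suc n) ∎
  where
  open ≡-Reasoning
  s₁ = sum {n} λ i → f (suc (toℕ i))
  s₂ = sum {n} λ i → f (suc (suc (toℕ i)))
  rearrange : ∀ x y z → x + y + z ≡ z + (y + x)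
  rearrange = solve-∀

argmax : ∀ {n} (f : Fin (suc n) → ℕ) → ∃[ i ] ∀ j → f j ≤ f i
argmax {zero}  f = zero , λ { zero → ≤-refl }
argmax {suc n} f with i , max ← argmax (f ∘ suc) with f zero ≤? f (suc i)
... | yes f₀≤ = suc i , λ { zero → f₀≤ ; (suc j) → max j }
... | no  f₀≰ = zero  , λ { zero → ≤-refl ; (suc j) → ≤-trans (max j) (≰⇒≥ f₀≰) }

⟦_⟧ : Bool → ℕ
⟦ b ⟧ = if b then 1 else 0

count : ∀ {n} → (Fin n → Bool) → ℕ
count b = sum λ i → ⟦ b i ⟧

count-not : ∀ {n} (b : Fin n → Bool) → count (not ∘ b) + count b ≡ n
count-not {n} b = begin
  count (not ∘ b) + count b          ≡⟨ ∑-distrib-+ (λ i → ⟦ not (b i) ⟧) (λ i → ⟦ b i ⟧) ⟨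
  sum (λ i → ⟦ not (b i) ⟧ + ⟦ b i ⟧)  ≡⟨ sum-cong-≗ (λ i → complementary (b i)) ⟩
  sum {n} (const 1)                  ≡⟨ sum-const n 1 ⟩
  n * 1                              ≡⟨ *-identityʳ n ⟩
  n                                  ∎
  where
  open ≡-Reasoning
  complementary : ∀ x → ⟦ not x ⟧ + ⟦ x ⟧ ≡ 1
  complementary true  = refl
  complementary false = refl

true⇒count-punchIn : ∀ {n} (b : Fin (suc n) → Bool) {i} → b i ≡ true →
                     count b ≡ suc (count (b ∘ punchIn i))
true⇒count-punchIn b {i} bi = trans (sum-remove {i = i} (λ j → ⟦ b j ⟧))
  (cong (λ x → ⟦ x ⟧ + count (b ∘ punchIn i)) bi)

injection⇒≤count : ∀ {p n} (b : Fin n → Bool) (g : Fin p → Fin n) → Injective _≡_ _≡_ g →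
                   (∀ y → b (g y) ≡ true) → p ≤ count b
injection⇒≤count {zero}          b g inj g-true = z≤n
injection⇒≤count {suc p} {zero}  b g inj g-true with () ← g zero
injection⇒≤count {suc p} {suc n} b g inj g-true = begin
  suc p                               ≤⟨ s≤s (injection⇒≤count _ g′ g′-injective g′-true) ⟩
  suc (count (b ∘ punchIn (g zero)))  ≡⟨ true⇒count-punchIn b (g-true zero) ⟨
  count b                             ∎
  where
  open ≤-Reasoning
  g₀≢ : ∀ y → g zero ≢ g (suc y)
  g₀≢ y eq with () ← inj eq
  g′ : Fin p → Fin n
  g′ y = punchOut (g₀≢ y)
  g′-true : ∀ y → b (punchIn (g zero) (g′ y)) ≡ true
  g′-true y = trans (cong b (punchIn-punchOut (g₀≢ y))) (g-true (suc y))
  g′-injective : Injective _≡_ _≡_ g′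
  g′-injective {x} {y} eq = Fin-suc-injective (inj (punchOut-injective (g₀≢ x) (g₀≢ y) eq))

cons-injection : ∀ {p n} (i : Fin (suc n)) (g : Fin p → Fin n) → Fin (suc p) → Fin (suc n)
cons-injection i g zero    = i
cons-injection i g (suc y) = punchIn i (g y)

cons-injective : ∀ {p n} (i : Fin (suc n)) (g : Fin p → Fin n) → Injective _≡_ _≡_ g →
                 Injective _≡_ _≡_ (cons-injection i g)
cons-injective i g inj {zero}  {zero}  eq = refl
cons-injective i g inj {zero}  {suc y} eq = contradiction (sym eq) (punchInᵢ≢i i (g y))
cons-injective i g inj {suc x} {zero}  eq = contradiction eq (punchInᵢ≢i i (g x))
cons-injective i g inj {suc x} {suc y} eq = cong suc (inj (punchIn-injective i (g x) (g y) eq))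

-- The image of `zero` is prescribed because this index is a centre of the double star and must land
-- on an end of a chosen edge. The other images are found after deleting `i`.
rooted-injection : ∀ {p n} (b : Fin n → Bool) {i} → b i ≡ true → suc p ≤ count b →
                   ∃[ g ] g zero ≡ i × Injective {A = Fin (suc p)} _≡_ _≡_ g × (∀ y → b (g y) ≡ true)

≤count⇒injection : ∀ {p n} (b : Fin n → Bool) → p ≤ count b →
                   ∃[ g ] Injective {A = Fin p} _≡_ _≡_ g × (∀ y → b (g y) ≡ true)
≤count⇒injection {zero}          b _   = (λ ()) , (λ { {()} }) , λ ()
≤count⇒injection {suc p} {suc n} b p≤ with b zero in b₀
... | true  = let g , _ , inj , g-true = rooted-injection b b₀ p<
              in g , inj , g-true
  where
  p< : suc p ≤ count b
  p< = ≤-trans p≤ (≤-reflexive (cong (λ x → ⟦ x ⟧ + count (b ∘ suc)) (sym b₀)))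
... | false = let g , inj , g-true = ≤count⇒injection (b ∘ suc) p≤
              in suc ∘ g , inj ∘ Fin-suc-injective , g-true

rooted-injection {p} {suc n} b {i} bi p<
  with g , inj , g-true ← ≤count⇒injection (b ∘ punchIn i)
         (s≤s⁻¹ (≤-trans p< (≤-reflexive (true⇒count-punchIn b bi))))
  = cons-injection i g , refl , cons-injective i g inj , λ { zero → bi ; (suc y) → g-true y }

-- Dominating sets, star-free graphs and degree sums along edges

deg₁ : ∀ {n m} → Grid n m → Fin n → ℕ
deg₁ H j = count λ i → H (j , i)

deg₂ : ∀ {n m} → Grid n m → Fin m → ℕ
deg₂ H i = count λ j → H (j , i)

∣∣≡sum-deg₂ : ∀ {n m} (H : Grid n m) → ∣ H ∣ ≡ sum (deg₂ H)
∣∣≡sum-deg₂ H = ∑-comm λ j i → ⟦ H (j , i) ⟧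

Sparse : ∀ {n m} → ℕ → Grid n m → Set
Sparse D H = ∀ j i → H (j , i) ≡ true → deg₁ H j + deg₂ H i ≤ D

∁ : ∀ {n m} → Grid n m → Grid n m
∁ A = not ∘ A

∣∁∣ : ∀ {n m} (A : Grid n m) → ∣ ∁ A ∣ + ∣ A ∣ ≡ n * m
∣∁∣ {n} {m} A = begin
  ∣ ∁ A ∣ + ∣ A ∣                        ≡⟨ ∑-distrib-+ (deg₁ (∁ A)) (deg₁ A) ⟨
  sum (λ j → deg₁ (∁ A) j + deg₁ A j)    ≡⟨ sum-cong-≗ (λ j → count-not (λ i → A (j , i))) ⟩
  sum {n} (const m)                      ≡⟨ sum-const n m ⟩
  n * m                                  ∎
  where open ≡-Reasoning

-- The neighbourhood omits the vertex itself, which costs nothing because the vertex is not in `A`.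
∣Nʳ∩∣ : ∀ {n m} (A : Grid n m) j i → A (j , i) ≡ false → ∣ Nʳ (j , i) ∩ A ∣ ≡ deg₂ A i
∣Nʳ∩∣ A j i A-false = sum-cong-≗ λ j′ → trans (sum-single i (off j′)) (on j′)
  where
  off : ∀ j′ i′ → i′ ≢ i → ⟦ (not (does (j′ ≟ j)) ∧ does (i′ ≟ i)) ∧ A (j′ , i′) ⟧ ≡ 0
  off j′ i′ i′≢i rewrite dec-false (i′ ≟ i) i′≢i with does (j′ ≟ j)
  ... | true  = refl
  ... | false = refl
  on : ∀ j′ → ⟦ (not (does (j′ ≟ j)) ∧ does (i ≟ i)) ∧ A (j′ , i) ⟧ ≡ ⟦ A (j′ , i) ⟧
  on j′ rewrite dec-true (i ≟ i) refl with j′ ≟ j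
  ... | yes refl = cong ⟦_⟧ (sym A-false)
  ... | no  _    = refl

∣Nᶜ∩∣ : ∀ {n m} (A : Grid n m) j i → A (j , i) ≡ false → ∣ Nᶜ (j , i) ∩ A ∣ ≡ deg₁ A j
∣Nᶜ∩∣ A j i A-false = trans (sum-single j λ j′ j′≢j → sum-zero (off j′ j′≢j)) (sum-cong-≗ on)
  where
  off : ∀ j′ → j′ ≢ j → ∀ i′ → ⟦ (does (j′ ≟ j) ∧ not (does (i′ ≟ i))) ∧ A (j′ , i′) ⟧ ≡ 0
  off j′ j′≢j i′ rewrite dec-false (j′ ≟ j) j′≢j = refl
  on : ∀ i′ → ⟦ (does (j ≟ j) ∧ not (does (i′ ≟ i))) ∧ A (j , i′) ⟧ ≡ ⟦ A (j , i′) ⟧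
  on i′ rewrite dec-true (j ≟ j) refl with i′ ≟ i
  ... | yes refl = cong ⟦_⟧ (sym A-false)
  ... | no  _    = refl

deg-∁ : ∀ {n m} (A : Grid n m) j i →
        (deg₁ (∁ A) j + deg₂ (∁ A) i) + (deg₂ A i + deg₁ A j) ≡ m + n
deg-∁ {n} {m} A j i = trans (rearrange (deg₁ (∁ A) j) (deg₂ (∁ A) i) (deg₂ A i) (deg₁ A j))
  (cong₂ _+_ (count-not (λ i → A (j , i))) (count-not (λ j → A (j , i))))
  where
  rearrange : ∀ x y z w → (x + y) + (z + w) ≡ (x + w) + (y + z)
  rearrange = solve-∀

module _ {n m k D : ℕ} (k+D : k + D ≡ m + n) (A : Grid n m) where

  -- A vertex outside `A` sees at least `k` elements of `A`. The two lines through it have lengths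
  -- adding up to m + n, so at most `D` is left for the complement.
  dominating⇒sparse-∁ : (∀ v → v ∈ 𝒯 (T k) A) → Sparse D (∁ A)
  dominating⇒sparse-∁ dominating j i ∁A-true with dominating (j , i)
  ... | inj₁ A-true with () ← trans (sym ∁A-true) (cong not A-true)
  ... | inj₂ (A-false , ∉T) = +-cancelʳ-≤ k _ _ (begin
    deg₁ (∁ A) j + deg₂ (∁ A) i + k                     ≤⟨ +-monoʳ-≤ (deg₁ (∁ A) j + deg₂ (∁ A) i) k≤ ⟩
    deg₁ (∁ A) j + deg₂ (∁ A) i + (deg₂ A i + deg₁ A j) ≡⟨ deg-∁ A j i ⟩
    m + n                                               ≡⟨ k+D ⟨
    k + D                                               ≡⟨ +-comm k D ⟩
    D + k                                               ∎)
    where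
    open ≤-Reasoning
    k≤ : k ≤ deg₂ A i + deg₁ A j
    k≤ = subst (k ≤_) (cong₂ _+_ (∣Nʳ∩∣ A j i A-false) (∣Nᶜ∩∣ A j i A-false)) (≮⇒≥ ∉T)

  sparse-∁⇒dominating : Sparse D (∁ A) → ∀ v → v ∈ 𝒯 (T k) A
  sparse-∁⇒dominating sparse (j , i) with A (j , i) in A-eq
  ... | true  = inj₁ refl
  ... | false = inj₂ (refl , ≤⇒≯ (subst (k ≤_) (sym (cong₂ _+_ (∣Nʳ∩∣ A j i A-eq) (∣Nᶜ∩∣ A j i A-eq)))
    (+-cancelˡ-≤ D _ _ (begin
      D + k                                               ≡⟨ +-comm D k ⟩
      k + D                                               ≡⟨ k+D ⟩
      m + n                                               ≡⟨ deg-∁ A j i ⟨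
      deg₁ (∁ A) j + deg₂ (∁ A) i + (deg₂ A i + deg₁ A j) ≤⟨ +-monoˡ-≤ _ (sparse j i (cong not A-eq)) ⟩
      D + (deg₂ A i + deg₁ A j)                           ∎))))
    where open ≤-Reasoning

StarFree : ∀ {n m} → ℕ → Grid n m → Set
StarFree {n} {m} a G = ∀ p q → (p , q) ∈ StarsOfSize a → ¬ Contains {n} {m} G (S p q)

module _ {n m a : ℕ} (G : Grid n m) where

  -- The two centres need degrees p + 1 and q + 1, whose sum a + 2 exceeds the bound on the edge
  -- joining them.
  sparse⇒starFree : Sparse (suc a) G → StarFree a G
  sparse⇒starFree sparse p q refl (f , g , f-inj , g-inj , edges) = 1+n≰n (begin
    suc (suc (p + q))                         ≡⟨ cong suc (+-suc p q) ⟨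
    suc p + suc q                             ≤⟨ +-mono-≤
      (injection⇒≤count (λ i → G (f zero , i)) g g-inj (λ y → edges zero y refl))
      (injection⇒≤count (λ j → G (j , g zero)) f f-inj at-v) ⟩
    deg₁ G (f zero) + deg₂ G (g zero)         ≤⟨ sparse (f zero) (g zero) (edges zero zero refl) ⟩
    suc (p + q)                               ∎)
    where
    open ≤-Reasoning
    at-v : ∀ x → G (f x , g zero) ≡ true
    at-v zero    = edges zero zero refl
    at-v (suc x) = edges (suc x) zero refl

  -- A violating edge has degree sum at least a + 2, which leaves room for `a` leaves besides its
  -- two ends. The leaves of the two centres lie in different parts, so they can be chosen
  -- independently.
  starFree⇒sparse : StarFree a G → Sparse (suc a) G
  starFree⇒sparse free j i G-true = ≮⇒≥ λ 1+a< →
    let p , q , p< , q< , p+q = split 1+a< 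
        g , g₀ , g-inj , g-true = rooted-injection (λ i → G (j , i)) G-true p<
        f , f₀ , f-inj , f-true = rooted-injection (λ j → G (j , i)) G-true q<
    in free p q p+q (f , g , f-inj , g-inj ,
         λ { zero    y    _ → trans (cong (λ z → G (z , g y)) f₀) (g-true y)
           ; (suc x) zero _ → trans (cong (λ z → G (f (suc x) , z)) g₀) (f-true (suc x)) })
    where
    positive : ∀ {n} (b : Fin n → Bool) i → b i ≡ true → 1 ≤ count b
    positive {suc n} b i bi = ≤-trans (s≤s z≤n) (≤-reflexive (sym (true⇒count-punchIn b bi)))
    split : suc a < deg₁ G j + deg₂ G i →
            ∃[ p ] ∃[ q ] p < deg₁ G j × q < deg₂ G i × p + q ≡ a
    split with deg₁ G j | positive (λ i → G (j , i)) i G-true | deg₂ G i | positive (λ j → G (j , i)) j G-true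
    ... | suc x | _ | suc y | _ = λ { (s≤s a<) → case a< }
      where
      case : a < x + suc y → _
      -- Take as many leaves at the first end as its degree allows, up to `a`, and the rest at the
      -- second end.
      case a< with x ≤? a
      ... | yes x≤a = x , a ∸ x , ≤-refl
                    , s≤s (m≤n+o⇒m∸n≤o a x (s≤s⁻¹ (≤-trans a< (≤-reflexive (+-suc x y))))) , m+[n∸m]≡n x≤a
      ... | no  x≰a = a , 0 , <-trans (≰⇒> x≰a) (n<1+n x) , s≤s z≤n , +-identityʳ a

-- Construction of the extremal graphs

+-divisor-/ : ∀ m n .{{_ : NonZero n}} → (m + n) / n ≡ m / n + 1
+-divisor-/ m n = trans (+-distrib-/-∣ʳ m ∣-refl) (cong (m / n +_) (n/n≡1 n))

-- Induction on `P`: the window moves by one, losing ⌊P/t⌋ and gaining ⌊(P + t)/t⌋ = ⌊P/t⌋ + 1.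
hermite-identity : ∀ t .{{_ : NonZero t}} P → sum {t} (λ j → (P + toℕ j) / t) ≡ P
hermite-identity t zero    = sum-zero λ j → m<n⇒m/n≡0 (toℕ<n j)
hermite-identity t (suc P) = +-cancelʳ-≡ (P / t) _ _ (begin
  sum {t} (λ j → (suc P + toℕ j) / t) + P / t
    ≡⟨ cong₂ _+_ (sum-cong-≗ {t} λ j → /-congˡ {o = t} (sym (+-suc P (toℕ j))))
                 (/-congˡ {o = t} (sym (+-identityʳ P))) ⟩
  sum {t} (λ j → (P + suc (toℕ j)) / t) + (P + 0) / t ≡⟨ sum-shift t (λ j → (P + j) / t) ⟩
  sum {t} (λ j → (P + toℕ j) / t) + (P + t) / t   ≡⟨ cong₂ _+_ (hermite-identity t P) (+-divisor-/ P t) ⟩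
  P + (P / t + 1)                                 ≡⟨ rearrange P (P / t) ⟩
  suc P + P / t                                   ∎)
  where
  open ≡-Reasoning
  rearrange : ∀ x y → x + (y + 1) ≡ suc x + y
  rearrange = solve-∀

+⟦<⟧ : ∀ {x y} → x ≤ y → y ≤ x + 1 → (x<?y : Dec (x < y)) → x + ⟦ does x<?y ⟧ ≡ y
+⟦<⟧ {x} x≤y y≤x+1 (yes x<y) = ≤-antisym (≤-trans (≤-reflexive (+-comm x 1)) x<y) y≤x+1
+⟦<⟧ {x} x≤y y≤x+1 (no  x≮y) = trans (+-identityʳ x) (≤-antisym x≤y (≮⇒≥ x≮y))

-- Filling the rows one after the other along the cyclic order of the columns, starting after
-- P cells, keeps all column counts of the form ⌊(P + toℕ j) / t⌋.
balanced-fill : ∀ {m} t .{{_ : NonZero t}} P (r : Fin m → ℕ) → (∀ i → r i ≤ t) →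
  ∃[ M ] (∀ i → deg₁ {m} {t} M i ≡ r i)
       × (∀ j → (P + toℕ j) / t + deg₂ M j ≡ (P + sum r + toℕ j) / t)
balanced-fill {zero}  t P r r≤t = (λ ()) , (λ ()) , λ j →
  trans (+-identityʳ _) (/-congˡ {o = t} (cong (_+ toℕ j) (sym (+-identityʳ P))))
balanced-fill {suc m} t P r r≤t
  with M , rows , columns ← balanced-fill t (P + r zero) (r ∘ suc) (r≤t ∘ suc)
  = M′ , rows′ , columns′
  where
  before after : Fin t → ℕ
  before j = (P + toℕ j) / t
  after  j = (P + r zero + toℕ j) / t

  M′ : Grid (suc m) t
  -- The row takes the columns whose count has to rise. As `r zero` is at most `t`, each count rises
  -- by at most one.
  M′ (zero  , j) = does (before j <? after j)
  M′ (suc i , j) = M (i , j)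

  first-row : ∀ j → before j + ⟦ M′ (zero , j) ⟧ ≡ after j
  first-row j = +⟦<⟧ (/-monoˡ-≤ t (+-monoˡ-≤ (toℕ j) (m≤m+n P (r zero)))) (begin
    (P + r zero + toℕ j) / t  ≤⟨ /-monoˡ-≤ t (+-monoˡ-≤ (toℕ j) (+-monoʳ-≤ P (r≤t zero))) ⟩
    (P + t + toℕ j) / t       ≡⟨ /-congˡ {o = t} (rearrange P t (toℕ j)) ⟩
    (P + toℕ j + t) / t       ≡⟨ +-divisor-/ (P + toℕ j) t ⟩
    before j + 1              ∎)
    (before j <? after j)
    where
    open ≤-Reasoning
    rearrange : ∀ x y z → x + y + z ≡ x + z + y
    rearrange = solve-∀

  rows′ : ∀ i → count (λ j → M′ (i , j)) ≡ r i
  -- Hermite's identity evaluates the column counts before and after as P and P + r zero; their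
  -- difference is the size of the row.
  rows′ zero    = +-cancelˡ-≡ P _ _ (begin
    P + count (λ j → M′ (zero , j))                  ≡⟨ cong (_+ count (λ j → M′ (zero , j))) (hermite-identity t P) ⟨
    sum before + count (λ j → M′ (zero , j))         ≡⟨ ∑-distrib-+ before (λ j → ⟦ M′ (zero , j) ⟧) ⟨
    sum (λ j → before j + ⟦ M′ (zero , j) ⟧)         ≡⟨ sum-cong-≗ first-row ⟩
    sum after                                        ≡⟨ hermite-identity t (P + r zero) ⟩
    P + r zero                                       ∎)
    where open ≡-Reasoning
  rows′ (suc i) = rows i

  columns′ : ∀ j → before j + count (λ i → M′ (i , j)) ≡ (P + sum r + toℕ j) / t
  columns′ j = begin
    before j + (⟦ M′ (zero , j) ⟧ + count (λ i → M (i , j)))  ≡⟨ +-assoc (before j) _ _ ⟨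
    before j + ⟦ M′ (zero , j) ⟧ + count (λ i → M (i , j))    ≡⟨ cong (_+ count (λ i → M (i , j))) (first-row j) ⟩
    after j + count (λ i → M (i , j))                         ≡⟨ columns j ⟩
    (P + r zero + sum (r ∘ suc) + toℕ j) / t                  ≡⟨ /-congˡ {o = t} (cong (_+ toℕ j) P+) ⟩
    (P + sum r + toℕ j) / t                                   ∎
    where
    open ≡-Reasoning
    P+ : P + r zero + sum (r ∘ suc) ≡ P + sum r
    P+ = +-assoc P (r zero) _

-- Both parts are split as `Fin σ ⊎ Fin t`: `inj₁` holds the vertices of degree h + 1 and `inj₂`
-- those of degree h.
record NearRegular (σ t h : ℕ) : Set where
  field
    graph        : Fin σ ⊎ Fin t → Fin σ ⊎ Fin t → Bool
    independent  : ∀ x y → graph (inj₁ x) (inj₁ y) ≡ false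

  G : Grid (σ + t) (σ + t)
  G (j , i) = graph (splitAt σ j) (splitAt σ i)

  weight : Fin σ ⊎ Fin t → ℕ
  weight = [ const (suc h) , const h ]′

  field
    degree₁ : ∀ u → count (λ x → graph u (inj₁ x)) + count (λ x → graph u (inj₂ x)) ≡ weight u
    degree₂ : ∀ u → count (λ x → graph (inj₁ x) u) + count (λ x → graph (inj₂ x) u) ≡ weight u

  deg₁-G : ∀ j → deg₁ G j ≡ weight (splitAt σ j)
  deg₁-G j = trans (sum-splitAt σ (λ v → ⟦ graph (splitAt σ j) v ⟧)) (degree₁ (splitAt σ j))

  deg₂-G : ∀ i → deg₂ G i ≡ weight (splitAt σ i)
  deg₂-G i = trans (sum-splitAt σ (λ v → ⟦ graph v (splitAt σ i) ⟧)) (degree₂ (splitAt σ i))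

  -- Only an edge between two vertices of degree h + 1 could exceed the bound, and `independent`
  -- excludes it.
  G-sparse : Sparse (suc (2 * h)) G
  G-sparse j i edge = subst (_≤ suc (2 * h)) (sym (cong₂ _+_ (deg₁-G j) (deg₂-G i)))
    (bound (splitAt σ j) (splitAt σ i) edge)
    where
    h+h : suc (h + h) ≡ suc (2 * h)
    h+h = cong (λ x → suc (h + x)) (sym (+-identityʳ h))
    bound : ∀ u v → graph u v ≡ true → weight u + weight v ≤ suc (2 * h)
    bound (inj₁ x) (inj₁ y) e with () ← trans (sym (independent x y)) e
    bound (inj₁ x) (inj₂ y) e = ≤-reflexive h+h
    bound (inj₂ x) (inj₁ y) e = ≤-reflexive (trans (+-suc h h) h+h)
    bound (inj₂ x) (inj₂ y) e = ≤-trans (n≤1+n (h + h)) (≤-reflexive h+h)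

  ∣G∣ : ∣ G ∣ ≡ (σ + t) * h + σ
  ∣G∣ = begin
    ∣ G ∣                                   ≡⟨ sum-cong-≗ deg₁-G ⟩
    sum (weight ∘ splitAt σ)                ≡⟨ sum-splitAt σ weight ⟩
    sum {σ} (const (suc h)) + sum {t} (const h) ≡⟨ cong₂ _+_ (sum-const σ (suc h)) (sum-const t h) ⟩
    σ * suc h + t * h                       ≡⟨ rearrange σ t h ⟩
    (σ + t) * h + σ                         ∎
    where
    open ≡-Reasoning
    rearrange : ∀ σ t h → σ * suc h + t * h ≡ (σ + t) * h + σ
    rearrange = solve-∀

nearRegular-0-sparse : ∀ {t h} (N : NearRegular 0 t h) → Sparse (2 * h) (NearRegular.G N)
nearRegular-0-sparse {h = h} N j i _ = ≤-reflexive
  (trans (cong₂ _+_ (deg₁-G j) (deg₂-G i)) (cong (h +_) (sym (+-identityʳ h))))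
  where open NearRegular N

-- Block construction: `SL` joins the `σ` special vertices to the `t` others, with rows of size h +
-- 1 and column counts `c`; its transpose serves the other side. `LL` supplies the h - c edges still
-- missing at each ordinary vertex. The bound on `σ` keeps `c` at most h.
nearRegular : ∀ {σ t h} → h < t → σ * suc h ≤ h * t → NearRegular σ t h
nearRegular {σ} {suc t-1} {h} h<t few
  with SL , SL-rows , SL-columns ← balanced-fill {σ} (suc t-1) 0 (const (suc h)) (const h<t)
  -- The second filling starts where the first one stopped. Together they place h * t cells, exactly
  -- h per column, so the columns of `LL` also complete `c` to h.
  = fill (balanced-fill (suc t-1) (σ * suc h) (λ i → h ∸ c i) λ i → ≤-trans (m∸n≤m h (c i)) (<⇒≤ h<t))
  where
  t = suc t-1

  c : Fin t → ℕ
  c j = count λ i → SL (i , j)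

  c≡ : ∀ j → c j ≡ (σ * suc h + toℕ j) / t
  c≡ j = begin
    c j                                  ≡⟨ cong (_+ c j) (m<n⇒m/n≡0 (toℕ<n j)) ⟨
    toℕ j / t + c j                      ≡⟨ SL-columns j ⟩
    (sum {σ} (const (suc h)) + toℕ j) / t ≡⟨ /-congˡ {o = t} (cong (_+ toℕ j) (sum-const σ (suc h))) ⟩
    (σ * suc h + toℕ j) / t              ∎
    where open ≡-Reasoning

  full : ∀ j → (h * t + toℕ j) / t ≡ h
  full j = begin
    (h * t + toℕ j) / t      ≡⟨ +-distrib-/-∣ˡ (toℕ j) (n∣m*n h) ⟩
    h * t / t + toℕ j / t    ≡⟨ cong₂ _+_ (m*n/n≡m h t) (m<n⇒m/n≡0 (toℕ<n j)) ⟩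
    h + 0                    ≡⟨ +-identityʳ h ⟩
    h                        ∎
    where open ≡-Reasoning

  c≤h : ∀ j → c j ≤ h
  c≤h j = begin
    c j                      ≡⟨ c≡ j ⟩
    (σ * suc h + toℕ j) / t  ≤⟨ /-monoˡ-≤ t (+-monoˡ-≤ (toℕ j) few) ⟩
    (h * t + toℕ j) / t      ≡⟨ full j ⟩
    h                        ∎
    where open ≤-Reasoning

  total : σ * suc h + sum (λ i → h ∸ c i) ≡ h * t
  total = begin
    σ * suc h + sum (λ i → h ∸ c i)          ≡⟨ cong (_+ sum (λ i → h ∸ c i)) (sum-const σ (suc h)) ⟨
    sum {σ} (const (suc h)) + sum (λ i → h ∸ c i) ≡⟨ cong (_+ sum (λ i → h ∸ c i)) (sum-cong-≗ SL-rows) ⟨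
    ∣ SL ∣ + sum (λ i → h ∸ c i)             ≡⟨ cong (_+ sum (λ i → h ∸ c i)) (∣∣≡sum-deg₂ SL) ⟩
    sum c + sum (λ i → h ∸ c i)              ≡⟨ ∑-distrib-+ c (λ i → h ∸ c i) ⟨
    sum (λ i → c i + (h ∸ c i))              ≡⟨ sum-cong-≗ (λ i → m+[n∸m]≡n (c≤h i)) ⟩
    sum {t} (const h)                        ≡⟨ sum-const t h ⟩
    t * h                                    ≡⟨ *-comm t h ⟩
    h * t                                    ∎
    where open ≡-Reasoning

  fill : ∃[ LL ] (∀ i → deg₁ {t} {t} LL i ≡ h ∸ c i)
               × (∀ j → (σ * suc h + toℕ j) / t + deg₂ LL j
                        ≡ (σ * suc h + sum (λ i → h ∸ c i) + toℕ j) / t) →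
         NearRegular σ t h
  fill (LL , LL-rows , LL-columns) = record
    { graph       = graph
    ; independent = λ x y → refl
    ; degree₁     = λ { (inj₁ x) → cong₂ _+_ (sum-zero {σ} λ _ → refl) (SL-rows x)
                      ; (inj₂ x) → trans (cong (c x +_) (LL-rows x)) (m+[n∸m]≡n (c≤h x)) }
    ; degree₂     = λ { (inj₁ x) → cong₂ _+_ (sum-zero {σ} λ _ → refl) (SL-rows x)
                      ; (inj₂ x) → large-column x }
    }
    where
    graph : Fin σ ⊎ Fin t → Fin σ ⊎ Fin t → Bool
    graph (inj₁ x) (inj₁ y) = false
    graph (inj₁ x) (inj₂ y) = SL (x , y)
    graph (inj₂ x) (inj₁ y) = SL (y , x)
    graph (inj₂ x) (inj₂ y) = LL (x , y)

    large-column : ∀ x → c x + count (λ i → LL (i , x)) ≡ h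
    large-column x = begin
      c x + count (λ i → LL (i , x))                     ≡⟨ cong (_+ count (λ i → LL (i , x))) (c≡ x) ⟩
      (σ * suc h + toℕ x) / t + count (λ i → LL (i , x)) ≡⟨ LL-columns x ⟩
      (σ * suc h + sum (λ i → h ∸ c i) + toℕ x) / t      ≡⟨ /-congˡ {o = t} (cong (_+ toℕ x) total) ⟩
      (h * t + toℕ x) / t                                ≡⟨ full x ⟩
      h                                                  ∎
      where open ≡-Reasoning

-- Upper bounds on the size of a sparse graph

degrees² : ∀ {n m} → Grid n m → ℕ
degrees² H = sum (λ j → deg₁ H j * deg₁ H j) + sum (λ i → deg₂ H i * deg₂ H i)

sum-edges-deg₁ : ∀ {n m} (H : Grid n m) →
  sum (λ j → sum λ i → ⟦ H (j , i) ⟧ * deg₁ H j) ≡ sum (λ j → deg₁ H j * deg₁ H j)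
sum-edges-deg₁ H = sum-cong-≗ λ j → sym (*-distribʳ-sum (deg₁ H j) (λ i → ⟦ H (j , i) ⟧))

-- Double counting: in the sum of degree sums over all edges, each vertex contributes its degree
-- once per incident edge, hence its square.
sparse⇒degrees²≤ : ∀ {n m D} (H : Grid n m) → Sparse D H → degrees² H ≤ ∣ H ∣ * D
sparse⇒degrees²≤ {n} {m} {D} H sparse = begin
  degrees² H
    ≡⟨ cong₂ _+_ (sum-edges-deg₁ H) (trans (∑-comm λ j i → e j i * deg₂ H i) (sum-edges-deg₁ Hᵀ)) ⟨
  sum (λ j → sum λ i → e j i * deg₁ H j) + sum (λ j → sum λ i → e j i * deg₂ H i)
                                                     ≡⟨ ∑-distrib-+ (λ j → sum λ i → e j i * deg₁ H j) _ ⟨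
  sum (λ j → (sum λ i → e j i * deg₁ H j) + sum λ i → e j i * deg₂ H i)
                                                     ≤⟨ sum-mono (λ j → begin
    (sum λ i → e j i * deg₁ H j) + (sum λ i → e j i * deg₂ H i) ≡⟨ ∑-distrib-+ (λ i → e j i * deg₁ H j) _ ⟨
    (sum λ i → e j i * deg₁ H j + e j i * deg₂ H i)             ≤⟨ sum-mono (per-edge j) ⟩
    (sum λ i → e j i * D)                                       ≡⟨ *-distribʳ-sum D (e j) ⟨
    deg₁ H j * D                                                ∎) ⟩
  sum (λ j → deg₁ H j * D)                           ≡⟨ *-distribʳ-sum D (deg₁ H) ⟨
  ∣ H ∣ * D                                          ∎
  where
  open ≤-Reasoning
  e : Fin n → Fin m → ℕ
  e j i = ⟦ H (j , i) ⟧
  Hᵀ : Grid m n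
  Hᵀ (i , j) = H (j , i)
  per-edge : ∀ j i → e j i * deg₁ H j + e j i * deg₂ H i ≤ e j i * D
  per-edge j i with H (j , i) in edge
  ... | false = z≤n
  ... | true  = subst₂ _≤_ (sym (cong₂ _+_ (*-identityˡ (deg₁ H j)) (*-identityˡ (deg₂ H i))))
                  (sym (*-identityˡ D)) (sparse j i edge)

-- The hypothesis bounds x² below by the linear function xD - κ. Summing over both sides gives twice
-- |H|D on the left, and one copy cancels against `sparse⇒degrees²≤`.
sparse⇒∣∣* : ∀ {n D κ} → (∀ x → x * D ≤ x * x + κ) →
             (H : Grid n n) → Sparse D H → ∣ H ∣ * D ≤ 2 * (n * κ)
sparse⇒∣∣* {n} {D} {κ} tangent H sparse = +-cancelˡ-≤ (∣ H ∣ * D) _ _ (begin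
  ∣ H ∣ * D + ∣ H ∣ * D                          ≡⟨ cong (λ x → ∣ H ∣ * D + x * D) (∣∣≡sum-deg₂ H) ⟩
  ∣ H ∣ * D + sum (deg₂ H) * D                   ≤⟨ +-mono-≤ (sum-tangent (deg₁ H)) (sum-tangent (deg₂ H)) ⟩
  (sum (λ j → deg₁ H j * deg₁ H j) + n * κ) + (sum (λ i → deg₂ H i * deg₂ H i) + n * κ)
    ≡⟨ rearrange (sum λ j → deg₁ H j * deg₁ H j) (sum λ i → deg₂ H i * deg₂ H i) (n * κ) ⟩
  degrees² H + 2 * (n * κ)                       ≤⟨ +-monoˡ-≤ _ (sparse⇒degrees²≤ H sparse) ⟩
  ∣ H ∣ * D + 2 * (n * κ)                        ∎)
  where
  open ≤-Reasoning
  rearrange : ∀ x y z → (x + z) + (y + z) ≡ (x + y) + 2 * z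
  rearrange = solve-∀
  sum-tangent : ∀ (f : Fin n → ℕ) → sum f * D ≤ sum (λ i → f i * f i) + n * κ
  sum-tangent f = begin
    sum f * D                                  ≡⟨ *-distribʳ-sum D f ⟩
    sum (λ i → f i * D)                        ≤⟨ sum-mono (λ i → tangent (f i)) ⟩
    sum (λ i → f i * f i + κ)                  ≡⟨ ∑-distrib-+ (λ i → f i * f i) (const κ) ⟩
    sum (λ i → f i * f i) + sum {n} (const κ)  ≡⟨ cong (sum (λ i → f i * f i) +_) (sum-const n κ) ⟩
    sum (λ i → f i * f i) + n * κ              ∎

-- This is (x - h)² ≥ 0, with slack d² for the distance d between x and h.
tangent-even : ∀ h x → x * (2 * h) ≤ x * x + h * h
tangent-even h x with ≤-total x h
... | inj₁ x≤h with d , refl ← m≤n⇒∃[o]m+o≡n x≤h = m+n≤o⇒m≤o _ (≤-reflexive (eq x d))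
  where
  eq : ∀ x d → x * (2 * (x + d)) + d * d ≡ x * x + (x + d) * (x + d)
  eq = solve-∀
... | inj₂ h≤x with d , refl ← m≤n⇒∃[o]m+o≡n h≤x = m+n≤o⇒m≤o _ (≤-reflexive (eq h d))
  where
  eq : ∀ h d → (h + d) * (2 * h) + d * d ≡ (h + d) * (h + d) + h * h
  eq = solve-∀

-- This is (x - h)(x - h - 1) ≥ 0, true because no integer lies strictly between h and h + 1. The
-- slack is d(d + 1) in both cases.
tangent-odd : ∀ h x → x * suc (2 * h) ≤ x * x + h * suc h
tangent-odd h x with x ≤? h
... | yes x≤h with d , refl ← m≤n⇒∃[o]m+o≡n x≤h = m+n≤o⇒m≤o _ (≤-reflexive (eq x d))
  where
  eq : ∀ x d → x * suc (2 * (x + d)) + d * suc d ≡ x * x + (x + d) * suc (x + d)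
  eq = solve-∀
... | no x≰h with d , refl ← m≤n⇒∃[o]m+o≡n (≰⇒> x≰h) = m+n≤o⇒m≤o _ (≤-reflexive (eq h d))
  where
  eq : ∀ h d → (suc h + d) * suc (2 * h) + d * suc d ≡ (suc h + d) * (suc h + d) + h * suc h
  eq = solve-∀

private
  swap-xy : ∀ x y → 2 * (x + y) ≡ x + y + x + y
  swap-xy = solve-∀

maxDegree-arithmetic : ∀ {N h m z} → suc N ≡ m + z → N ≤ 2 * h → h < m →
                       m * (suc (2 * h) ∸ m) + z * m ≤ N * suc h
maxDegree-arithmetic {N} {h} {m} {z} 1+N≡m+z N≤2h h<m
  -- Substitute m = h + 1 + x, h = x + y and y = z + w, where y is 2h + 1 - m; the last two are
  -- possible because N = h + x + z ≤ 2h. The slack is then 2x² + 2x + xw.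
  with x , refl ← m≤n⇒∃[o]m+o≡n h<m
  with refl ← suc-injective 1+N≡m+z
  with y , refl ← m≤n⇒∃[o]m+o≡n {x} {h} (+-cancelˡ-≤ h x h
         (≤-trans (m≤m+n (h + x) z) (≤-trans N≤2h (≤-reflexive (cong (h +_) (+-identityʳ h))))))
  with w , refl ← m≤n⇒∃[o]m+o≡n {z} {y}
         (+-cancelˡ-≤ (x + y + x) z y (≤-trans N≤2h (≤-reflexive (swap-xy x y))))
  = begin
    (suc (x + y) + x) * (suc (2 * (x + y)) ∸ (suc (x + y) + x)) + z * (suc (x + y) + x)
      ≡⟨ cong (λ u → (suc (x + y) + x) * u + z * (suc (x + y) + x)) monus ⟩
    (suc (x + y) + x) * y + z * (suc (x + y) + x)
      ≤⟨ m+n≤o⇒m≤o _ (≤-reflexive (eq x z w)) ⟩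
    (x + y + x + z) * suc (x + y) ∎
  where
  open ≤-Reasoning
  monus : suc (2 * (x + y)) ∸ (suc (x + y) + x) ≡ y
  monus = trans (cong (_∸ (x + y + x)) (swap-xy x y)) (m+n∸m≡n (x + y + x) y)
  eq : ∀ x z w → ((suc (x + (z + w)) + x) * (z + w) + z * (suc (x + (z + w)) + x))
                 + (2 * (x * x) + 2 * x + x * w)
       ≡ (x + (z + w) + x + z) * suc (x + (z + w))
  eq = solve-∀

-- Columns adjacent to `j` have degree at most D - m by sparsity, the others at most m by the choice
-- of `j`, where m is the degree of `j`.
maxDegree₁-bound : ∀ {N h} → h ≤ N → N ≤ 2 * h → (H : Grid (suc N) (suc N)) →
                   Sparse (suc (2 * h)) H → ∀ j → (∀ i → deg₂ H i ≤ deg₁ H j) → ∣ H ∣ ≤ N * suc h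
maxDegree₁-bound {N} {h} h≤N N≤2h H sparse j max with h <? deg₁ H j
... | no h≮m = begin
  ∣ H ∣                  ≡⟨ ∣∣≡sum-deg₂ H ⟩
  sum (deg₂ H)           ≤⟨ sum-mono (λ i → ≤-trans (max i) (≮⇒≥ h≮m)) ⟩
  sum {suc N} (const h)  ≡⟨ sum-const (suc N) h ⟩
  -- If all column degrees are at most h, the total (N + 1)h is within the bound because h ≤ N.
  h + N * h              ≤⟨ +-monoˡ-≤ (N * h) h≤N ⟩
  N + N * h              ≡⟨ *-suc N h ⟨
  N * suc h              ∎
  where open ≤-Reasoning
... | yes h<m = begin
  ∣ H ∣                                                    ≡⟨ ∣∣≡sum-deg₂ H ⟩
  sum (deg₂ H)                                             ≤⟨ sum-mono column ⟩
  sum (λ i → ⟦ b i ⟧ * (D ∸ m) + ⟦ not (b i) ⟧ * m)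
    ≡⟨ ∑-distrib-+ (λ i → ⟦ b i ⟧ * (D ∸ m)) (λ i → ⟦ not (b i) ⟧ * m) ⟩
  sum (λ i → ⟦ b i ⟧ * (D ∸ m)) + sum (λ i → ⟦ not (b i) ⟧ * m)
    ≡⟨ cong₂ _+_ (*-distribʳ-sum (D ∸ m) (λ i → ⟦ b i ⟧)) (*-distribʳ-sum m (λ i → ⟦ not (b i) ⟧)) ⟨
  m * (D ∸ m) + count (not ∘ b) * m
    ≤⟨ maxDegree-arithmetic {z = count (not ∘ b)} (sym (trans (+-comm m _) (count-not b))) N≤2h h<m ⟩
  N * suc h                                                ∎
  where
  open ≤-Reasoning
  m = deg₁ H j
  D = suc (2 * h)
  b : Fin (suc N) → Bool
  b i = H (j , i)
  column : ∀ i → deg₂ H i ≤ ⟦ b i ⟧ * (D ∸ m) + ⟦ not (b i) ⟧ * m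
  column i with H (j , i) in edge
  ... | true  = ≤-trans (m+n≤o⇒m≤o∸n (deg₂ H i) (≤-trans (≤-reflexive (+-comm _ m)) (sparse j i edge)))
                  (≤-reflexive (sym (trans (+-identityʳ _) (+-identityʳ _))))
  ... | false = ≤-trans (max i) (≤-reflexive (sym (+-identityʳ m)))

maxDegree-bound : ∀ {N h} → h ≤ N → N ≤ 2 * h → (H : Grid (suc N) (suc N)) →
                  Sparse (suc (2 * h)) H → ∣ H ∣ ≤ N * suc h
maxDegree-bound {N} {h} h≤N N≤2h H sparse
  with j , max₁ ← argmax (deg₁ H) | i , max₂ ← argmax (deg₂ H) with ≤-total (deg₂ H i) (deg₁ H j)
... | inj₁ i≤j = maxDegree₁-bound h≤N N≤2h H sparse j λ i′ → ≤-trans (max₂ i′) i≤j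
... | inj₂ j≤i = subst (_≤ N * suc h) (sym (∣∣≡sum-deg₂ H))
  (maxDegree₁-bound h≤N N≤2h (H ∘ swap)
    (λ i′ j′ edge → subst (_≤ suc (2 * h)) (+-comm (deg₁ H j′) _) (sparse j′ i′ edge))
    i (λ j′ → ≤-trans (max₁ j′) j≤i))

-- The extremal values

open import Data.Integer using (+_; _-_; _⊖_)
import Data.Integer.Properties as ℤ

record MaxSparse (n D e : ℕ) : Set where
  field
    extremal : Grid n n
    sparse   : Sparse D extremal
    size     : ∣ extremal ∣ ≡ e
    maximal  : ∀ (H : Grid n n) → Sparse D H → ∣ H ∣ ≤ e

-- Needed because `∁ (∁ G)` and `G` are identified only pointwise.
Sparse-cong : ∀ {n m D} {G H : Grid n m} → (∀ v → G v ≡ H v) → Sparse D G → Sparse D H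
Sparse-cong {D = D} G≗H sparse j i edge =
  subst (_≤ D) (cong₂ _+_ (sum-cong-≗ λ i′ → cong ⟦_⟧ (G≗H (j , i′)))
                          (sum-cong-≗ λ j′ → cong ⟦_⟧ (G≗H (j′ , i))))
    (sparse j i (trans (G≗H (j , i)) edge))

maxSparse⇒ex : ∀ {n a e} → MaxSparse n (suc a) e → IsEx n n (StarsOfSize a) e
maxSparse⇒ex maxSparse = (extremal , sparse⇒starFree extremal sparse , size) ,
  λ { j (H , free , refl) → maximal H (starFree⇒sparse H free) }
  where open MaxSparse maxSparse

maxSparse⇒γ : ∀ {n k D e g} → k + D ≡ n + n → e + g ≡ n * n → MaxSparse n D e → Isγ (T k) n n g
maxSparse⇒γ {n} {k} {D} {e} {g} k+D e+g maxSparse =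
  (∁ extremal , sparse-∁⇒dominating k+D (∁ extremal) ∁∁-sparse , ∁-size) ,
  λ { j (A , dominating , refl) → +-cancelˡ-≤ e g _ (begin
    e + g            ≡⟨ e+g ⟩
    n * n            ≡⟨ ∣∁∣ A ⟨
    ∣ ∁ A ∣ + ∣ A ∣  ≤⟨ +-monoˡ-≤ ∣ A ∣ (maximal (∁ A) (dominating⇒sparse-∁ k+D A dominating)) ⟩
    e + ∣ A ∣        ∎) }
  where
  open ≤-Reasoning
  open MaxSparse maxSparse
  ∁∁-sparse : Sparse D (∁ (∁ extremal))
  ∁∁-sparse = Sparse-cong (λ v → sym (not-involutive (extremal v))) sparse
  ∁-size : ∣ ∁ extremal ∣ ≡ g
  ∁-size = +-cancelʳ-≡ e _ _ (begin-equality
    ∣ ∁ extremal ∣ + e               ≡⟨ cong (λ x → ∣ ∁ extremal ∣ + x) size ⟨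
    ∣ ∁ extremal ∣ + ∣ extremal ∣    ≡⟨ ∣∁∣ extremal ⟩
    n * n                            ≡⟨ e+g ⟨
    e + g                            ≡⟨ +-comm e g ⟩
    g + e                            ∎)

+e≡+[e+g]-+g : ∀ {e g x} → e + g ≡ x → + e ≡ + x - + g
+e≡+[e+g]-+g {e} {g} refl = sym (begin
  + (e + g) - + g       ≡⟨ ℤ.m-n≡m⊖n (e + g) g ⟩
  (e + g) ⊖ g           ≡⟨ ℤ.⊖-≥ (m≤n+m g e) ⟩
  + (e + g ∸ g)         ≡⟨ cong +_ (m+n∸n≡m e g) ⟩
  + e                   ∎)
  where open ≡-Reasoning

maxSparse-even : ∀ {n h} → 1 ≤ h → h < n → MaxSparse n (2 * h) (n * h)
maxSparse-even {n} {h@(suc _)} _ h<n = record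
  { extremal = NearRegular.G regular
  ; sparse   = nearRegular-0-sparse regular
  ; size     = trans (NearRegular.∣G∣ regular) (+-identityʳ (n * h))
  ; maximal  = λ H sparse → *-cancelʳ-≤ ∣ H ∣ (n * h) (2 * h) (begin
      ∣ H ∣ * (2 * h)   ≤⟨ sparse⇒∣∣* (tangent-even h) H sparse ⟩
      2 * (n * (h * h)) ≡⟨ rearrange n h ⟩
      n * h * (2 * h)   ∎)
  }
  where
  open ≤-Reasoning
  regular : NearRegular 0 n h
  regular = nearRegular h<n z≤n
  rearrange : ∀ n h → 2 * (n * (h * h)) ≡ n * h * (2 * h)
  rearrange = solve-∀

-- With n = s + h + 1, the condition s ≤ h says n ≤ 2h + 1. The number of special vertices is s = n
-- - h - 1, leaving t = h + 1.
maxSparse-odd-large : ∀ {s h} → s ≤ h → MaxSparse (s + suc h) (suc (2 * h)) ((s + h) * suc h)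
maxSparse-odd-large {s} {h} s≤h = record
  { extremal = NearRegular.G regular
  ; sparse   = NearRegular.G-sparse regular
  ; size     = trans (NearRegular.∣G∣ regular) (rearrange s h)
  ; maximal  = subst (λ n → ∀ (H : Grid n n) → Sparse (suc (2 * h)) H → ∣ H ∣ ≤ (s + h) * suc h)
                 (sym (+-suc s h))
                 (maxDegree-bound (m≤n+m h s) (+-mono-≤ s≤h (≤-reflexive (sym (+-identityʳ h)))))
  }
  where
  regular : NearRegular s (suc h) h
  regular = nearRegular ≤-refl (*-monoˡ-≤ (suc h) s≤h)
  rearrange : ∀ s h → (s + suc h) * h + s ≡ (s + h) * suc h
  rearrange = solve-∀

-- The tangent bound reads |H|D ≤ nhD + nh, so dividing by D leaves nh + σ. The same floor gives σD
-- ≤ nh, which after cancelling σh is the condition σ(h + 1) ≤ ht of `nearRegular`.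
maxSparse-odd-small : ∀ {σ t h} → h < t → σ ≡ (σ + t) * h / suc (2 * h) →
                      MaxSparse (σ + t) (suc (2 * h)) ((σ + t) * h + σ)
maxSparse-odd-small {σ} {t} {h} h<t σ≡ = record
  { extremal = NearRegular.G regular
  ; sparse   = NearRegular.G-sparse regular
  ; size     = NearRegular.∣G∣ regular
  ; maximal  = λ H sparse → begin
      ∣ H ∣                             ≡⟨ m*n/n≡m ∣ H ∣ D ⟨
      ∣ H ∣ * D / D                     ≤⟨ /-monoˡ-≤ D (sparse⇒∣∣* (tangent-odd h) H sparse) ⟩
      2 * (n * (h * suc h)) / D         ≡⟨ /-congˡ {o = D} (rearrange₁ n h) ⟩
      (n * h * D + n * h) / D           ≡⟨ +-distrib-/-∣ˡ (n * h) (n∣m*n (n * h)) ⟩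
      n * h * D / D + n * h / D         ≡⟨ cong₂ _+_ (m*n/n≡m (n * h) D) (sym σ≡) ⟩
      n * h + σ                         ∎
  }
  where
  open ≤-Reasoning
  n = σ + t
  D = suc (2 * h)
  rearrange₁ : ∀ n h → 2 * (n * (h * suc h)) ≡ n * h * suc (2 * h) + n * h
  rearrange₁ = solve-∀
  rearrange₂ : ∀ σ h → σ * suc h + σ * h ≡ σ * suc (2 * h)
  rearrange₂ = solve-∀
  rearrange₃ : ∀ σ t h → (σ + t) * h ≡ h * t + σ * h
  rearrange₃ = solve-∀
  regular : NearRegular σ t h
  regular = nearRegular h<t (+-cancelʳ-≤ (σ * h) _ _ (begin
    σ * suc h + σ * h    ≡⟨ rearrange₂ σ h ⟩
    σ * D                ≡⟨ cong (_* D) σ≡ ⟩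
    n * h / D * D        ≤⟨ m/n*n≤m (n * h) D ⟩
    n * h                ≡⟨ rearrange₃ σ t h ⟩
    h * t + σ * h        ∎))

-- Here `r` is what `p` lacks to the next multiple of `d`. The d - 1 added before dividing is r + u,
-- and the leftover u is less than d.
⌈/⌉-unique : ∀ {p d q r} .{{_ : NonZero d}} → p + r ≡ q * d → r < d → ⌈ p / d ⌉ ≡ q
⌈/⌉-unique {p} {suc d-1} {q} {r} p+r≡ (s≤s r≤d-1) with u , refl ← m≤n⇒∃[o]m+o≡n r≤d-1 = begin
  (p + (r + u)) / d      ≡⟨ /-congˡ {o = d} (+-assoc p r u) ⟨
  (p + r + u) / d        ≡⟨ /-congˡ {o = d} (cong (_+ u) p+r≡) ⟩
  (q * d + u) / d        ≡⟨ +-distrib-/-∣ˡ u (n∣m*n q) ⟩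
  q * d / d + u / d      ≡⟨ cong₂ _+_ (m*n/n≡m q d) (m<n⇒m/n≡0 (s≤s (m≤n+m u r))) ⟩
  q + 0                  ≡⟨ +-identityʳ q ⟩
  q                      ∎
  where
  open ≡-Reasoning
  d = suc (r + u)

parity : ∀ n → ∃[ h ] (n ≡ 2 * h ⊎ n ≡ suc (2 * h))
parity zero = 0 , inj₁ refl
parity (suc n) with parity n
... | h , inj₁ refl = h , inj₂ refl
... | h , inj₂ refl = suc h , inj₁ (sym (cong suc (+-suc h (h + 0))))

2∤1+2* : ∀ s → 2 ∤ suc (2 * s)
2∤1+2* s (divides q eq) = even≢odd q s (trans (*-comm 2 q) (sym eq))

2*/2 : ∀ s → 2 * s / 2 ≡ s
2*/2 s = trans (/-congˡ {o = 2} (*-comm 2 s)) (m*n/n≡m s 2)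

-- `k` is a free parameter here, so that it can be replaced by `2 * s` or `suc (2 * s)` in the cases
-- below.
Conclusion : (n a k : ℕ) .{{_ : NonZero (2 * (2 * n ∸ k))}} → Set
Conclusion n a k =
  ∃[ e ] ∃[ g ]
    IsEx n n (StarsOfSize a) e
    × Isγ (T k) n n g
    × + e ≡ + (n * n) - + g
    × (2 ∣ k → g ≡ k * n / 2)
    × (2 ∤ k → k ≤ n → g ≡ (k + 1) / 2 * n ∸ (k ∸ 1) / 2)
    × (2 ∤ k → n < k →
         g ≡ (k ∸ 1) / 2 * n + ⌈ n * (2 * n ∸ k + 1) / (2 * (2 * n ∸ k)) ⌉)

conclude-even : ∀ {n a} s h .{{_ : NonZero (2 * (2 * n ∸ 2 * s))}} → n ≡ s + h →
               suc a ≡ 2 * h → 1 ≤ h → 1 ≤ s →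
                Conclusion n a (2 * s)
conclude-even {n} {a} s h refl D≡ 1≤h 1≤s =
  n * h , s * n , maxSparse⇒ex maxSparse , maxSparse⇒γ k+D e+g maxSparse , +e≡+[e+g]-+g e+g ,
  (λ _ → sym (trans (/-congˡ {o = 2} (*-assoc 2 s n)) (2*/2 (s * n)))) ,
  (λ 2∤k → contradiction 2∣k 2∤k) , (λ 2∤k → contradiction 2∣k 2∤k)
  where
  maxSparse : MaxSparse n (suc a) (n * h)
  maxSparse = subst (λ D → MaxSparse n D (n * h)) (sym D≡) (maxSparse-even 1≤h (m<n+m h 1≤s))
  rearrange₁ : ∀ s h → 2 * s + 2 * h ≡ (s + h) + (s + h)
  rearrange₁ = solve-∀
  k+D : 2 * s + suc a ≡ n + n
  k+D = trans (cong (λ x → 2 * s + x) D≡) (rearrange₁ s h)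
  rearrange₂ : ∀ s h → (s + h) * h + s * (s + h) ≡ (s + h) * (s + h)
  rearrange₂ = solve-∀
  e+g : n * h + s * n ≡ n * n
  e+g = rearrange₂ s h
  2∣k : 2 ∣ 2 * s
  2∣k = divides s (*-comm 2 s)

[k+1]/2 : ∀ s → (suc (2 * s) + 1) / 2 ≡ suc s
[k+1]/2 s = trans (/-congˡ {o = 2} (rearrange s)) (2*/2 (suc s))
  where
  rearrange : ∀ s → suc (2 * s) + 1 ≡ 2 * suc s
  rearrange = solve-∀

odd-k+D : ∀ s h → suc (2 * s) + suc (2 * h) ≡ (s + suc h) + (s + suc h)
odd-k+D = solve-∀

-- Small `k` means large D = 2h + 1: k ≤ n amounts to s ≤ h, the condition of `maxSparse-odd-large`.
conclude-odd-small-k : ∀ {n} s h .{{_ : NonZero (2 * (2 * n ∸ suc (2 * s)))}} → n ≡ s + suc h →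
                       suc (2 * s) ≤ n → Conclusion n (2 * h) (suc (2 * s))
conclude-odd-small-k {n} s h refl k≤n =
  e , suc s * n ∸ s , maxSparse⇒ex maxSparse , maxSparse⇒γ k+D e+g maxSparse , +e≡+[e+g]-+g e+g ,
  (λ 2∣k → contradiction 2∣k (2∤1+2* s)) ,
  (λ _ _ → sym (cong₂ (λ x y → x * n ∸ y) ([k+1]/2 s) (2*/2 s))) ,
  (λ _ n<k → contradiction k≤n (<⇒≱ n<k))
  where
  e = (s + h) * suc h
  s≤h : s ≤ h
  s≤h = s≤s⁻¹ (+-cancelˡ-≤ s _ _ (subst (_≤ n) (rearrange′ s) k≤n))
    where
    rearrange′ : ∀ s → suc (2 * s) ≡ s + suc s
    rearrange′ = solve-∀
  maxSparse : MaxSparse n (suc (2 * h)) e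
  maxSparse = maxSparse-odd-large s≤h
  k+D = odd-k+D s h
  rearrange : ∀ s h → (s + h) * suc h + suc s * (s + suc h) ≡ (s + suc h) * (s + suc h) + s
  rearrange = solve-∀
  e+g : e + (suc s * n ∸ s) ≡ n * n
  e+g = begin
    e + (suc s * n ∸ s)  ≡⟨ +-∸-assoc e (≤-trans (m≤m+n s (suc h)) (m≤m+n n (s * n))) ⟨
    e + suc s * n ∸ s    ≡⟨ cong (_∸ s) (rearrange s h) ⟩
    n * n + s ∸ s        ≡⟨ m+n∸n≡m (n * n) s ⟩
    n * n                ∎
    where open ≡-Reasoning

conclude-odd-large-k : ∀ {n} s h .{{_ : NonZero (2 * (2 * n ∸ suc (2 * s)))}} → n ≡ s + suc h →
                       n < suc (2 * s) → Conclusion n (2 * h) (suc (2 * s))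
conclude-odd-large-k {n} s h n≡ n<k =
  n * h + σ , s * n + t , maxSparse⇒ex maxSparse , maxSparse⇒γ k+D e+g maxSparse , +e≡+[e+g]-+g e+g ,
  (λ 2∣k → contradiction 2∣k (2∤1+2* s)) ,
  (λ _ k≤n → contradiction k≤n (<⇒≱ n<k)) ,
  (λ _ _ → cong₂ (λ x y → x * n + y) (sym (2*/2 s)) (sym (⌈/⌉-unique ceiling-eq ceiling-<)))
  where
  D = suc (2 * h)
  σ = n * h / D
  ρ = n * h % D
  t = n ∸ σ

  k+D : suc (2 * s) + D ≡ n + n
  k+D = trans (odd-k+D s h) (sym (cong₂ _+_ n≡ n≡))

  σ≤n : σ ≤ n
  σ≤n = ≤-trans (/-monoˡ-≤ D (*-monoʳ-≤ n (≤-trans (m≤m+n h (h + 0)) (n≤1+n _)))) (≤-reflexive (m*n/n≡m n D))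

  σ+t : σ + t ≡ n
  σ+t = m+[n∸m]≡n σ≤n

  h<s : h < s
  h<s = +-cancelˡ-≤ s _ _ (subst₂ _≤_ n≡ (cong (λ x → s + x) (+-identityʳ s)) (s≤s⁻¹ n<k))

  n*h≡ : n * h ≡ ρ + σ * D
  n*h≡ = m≡m%n+[m/n]*n (n * h) D

  -- Since nh + n(h + 1) = nD, the floor `σ` of nh/D and the ceiling of n(h + 1)/D add up to n. So
  -- that ceiling is `t`.
  n*[1+h] : n * suc h + ρ ≡ t * D
  n*[1+h] = +-cancelˡ-≡ (σ * D) _ _ (begin
    σ * D + (n * suc h + ρ)   ≡⟨ rearrange₁ (σ * D) (n * suc h) ρ ⟩
    (ρ + σ * D) + n * suc h   ≡⟨ cong (_+ n * suc h) n*h≡ ⟨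
    n * h + n * suc h         ≡⟨ rearrange₂ n h ⟩
    n * D                     ≡⟨ cong (_* D) σ+t ⟨
    (σ + t) * D               ≡⟨ *-distribʳ-+ D σ t ⟩
    σ * D + t * D             ∎)
    where
    open ≡-Reasoning
    rearrange₁ : ∀ x y z → x + (y + z) ≡ (z + x) + y
    rearrange₁ = solve-∀
    rearrange₂ : ∀ n h → n * h + n * suc h ≡ n * suc (2 * h)
    rearrange₂ = solve-∀

  D≤n : D ≤ n
  D≤n = begin
    suc (h + (h + 0))  ≡⟨ cong (λ x → suc (h + x)) (+-identityʳ h) ⟩
    suc h + h          ≤⟨ +-mono-≤ h<s (n≤1+n h) ⟩
    s + suc h          ≡⟨ n≡ ⟨
    n                  ∎
    where open ≤-Reasoning

  h<t : h < t
  h<t = *-cancelʳ-< D h t (begin-strict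
    h * D           ≡⟨ *-comm h D ⟩
    D * h           <⟨ *-monoʳ-< D (n<1+n h) ⟩
    D * suc h       ≤⟨ *-monoˡ-≤ (suc h) D≤n ⟩
    n * suc h       ≤⟨ m≤m+n _ ρ ⟩
    n * suc h + ρ   ≡⟨ n*[1+h] ⟩
    t * D           ∎)
    where open ≤-Reasoning

  maxSparse : MaxSparse n D (n * h + σ)
  maxSparse = subst (λ x → MaxSparse x D (x * h + σ)) σ+t
    (maxSparse-odd-small h<t (/-congˡ {o = D} (cong (_* h) (sym σ+t))))

  e+g : n * h + σ + (s * n + t) ≡ n * n
  e+g = begin
    n * h + σ + (s * n + t)     ≡⟨ rearrange₁ (n * h) σ (s * n) t ⟩
    n * h + s * n + (σ + t)     ≡⟨ cong (λ x → n * h + s * n + x) σ+t ⟩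
    n * h + s * n + n           ≡⟨ rearrange₂ n h s ⟩
    n * (s + suc h)             ≡⟨ cong (n *_) n≡ ⟨
    n * n                       ∎
    where
    open ≡-Reasoning
    rearrange₁ : ∀ x y z w → x + y + (z + w) ≡ x + z + (y + w)
    rearrange₁ = solve-∀
    rearrange₂ : ∀ n h s → n * h + s * n + n ≡ n * (s + suc h)
    rearrange₂ = solve-∀

  2n∸k : 2 * n ∸ suc (2 * s) ≡ D
  2n∸k = trans (cong (_∸ suc (2 * s)) (trans (cong (λ x → n + x) (+-identityʳ n)) (sym k+D)))
               (m+n∸m≡n (suc (2 * s)) D)

  -- With 2n - k = D the fraction is n(2h + 2)/(2D), so both sides of `n*[1+h]` are doubled and the
  -- remainder becomes 2ρ.
  ceiling-eq : n * (2 * n ∸ suc (2 * s) + 1) + 2 * ρ ≡ t * (2 * (2 * n ∸ suc (2 * s)))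
  ceiling-eq = subst (λ d → n * (d + 1) + 2 * ρ ≡ t * (2 * d)) (sym 2n∸k) (begin
    n * (D + 1) + 2 * ρ      ≡⟨ rearrange₁ n h ρ ⟩
    2 * (n * suc h + ρ)      ≡⟨ cong (2 *_) n*[1+h] ⟩
    2 * (t * D)              ≡⟨ rearrange₂ t D ⟩
    t * (2 * D)              ∎)
    where
    open ≡-Reasoning
    rearrange₁ : ∀ n h ρ → n * (suc (2 * h) + 1) + 2 * ρ ≡ 2 * (n * suc h + ρ)
    rearrange₁ = solve-∀
    rearrange₂ : ∀ t D → 2 * (t * D) ≡ t * (2 * D)
    rearrange₂ = solve-∀

  ceiling-< : 2 * ρ < 2 * (2 * n ∸ suc (2 * s))
  ceiling-< = subst (λ d → 2 * ρ < 2 * d) (sym 2n∸k) (*-monoʳ-< 2 (m%n<n (n * h) D))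

private
  2*[h+s] : ∀ h s → 2 * (h + s) ≡ 2 * s + 2 * h
  2*[h+s] = solve-∀

  2*[1+h+s] : ∀ h s → 2 * (suc h + s) ≡ suc (2 * s) + suc (2 * h)
  2*[1+h+s] = solve-∀

conclude : ∀ n a k .{{_ : NonZero (2 * (2 * n ∸ k))}} → k + suc a ≡ 2 * n → 1 ≤ k →
           Conclusion n a k
conclude n a k k+D 1≤k with parity (suc a)
-- As k + (a + 1) = 2n, the parity of a + 1 decides that of `k`. Subtracting gives n = h + s and
-- then k = 2s.
... | h , inj₁ D≡
  with s , refl ← m≤n⇒∃[o]m+o≡n {h} {n}
    (*-cancelˡ-≤ 2 (m+n≤o⇒n≤o k (≤-reflexive (trans (cong (λ D → k + D) (sym D≡)) k+D))))
  with refl ← +-cancelʳ-≡ (suc a) k (2 * s)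
    (trans k+D (trans (2*[h+s] h s) (cong (λ D → 2 * s + D) (sym D≡))))
  = conclude-even s h (+-comm h s) D≡
      (*-cancelˡ-< 2 0 h (≤-trans (s≤s z≤n) (≤-reflexive D≡)))
      (*-cancelˡ-< 2 0 s 1≤k)
... | h , inj₂ refl
  -- Positivity of `k` gives 2(h + 1) ≤ 2n, so `s` can be taken as n - h - 1.
  with s , refl ← m≤n⇒∃[o]m+o≡n {suc h} {n}
    (*-cancelˡ-≤ 2 (subst₂ _≤_ (sym (*-suc 2 h)) k+D (+-monoˡ-≤ (suc (2 * h)) 1≤k)))
  with refl ← +-cancelʳ-≡ (suc (2 * h)) k (suc (2 * s)) (trans k+D (2*[1+h+s] h s))
  with suc (2 * s) ≤? suc h + s
... | yes k≤n = conclude-odd-small-k s h (+-comm (suc h) s) k≤n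
... | no  k≰n = conclude-odd-large-k s h (+-comm (suc h) s) (≰⇒> k≰n)

-- Makes the truncated subtractions of the statement exact, for M = m + n in the duality and M = 2n
-- in the extremal problem.
∸1∸-bounds : ∀ {M a} → 2 ≤ M → a ≤ M ∸ 2 → (M ∸ 1 ∸ a) + suc a ≡ M × 1 ≤ M ∸ 1 ∸ a
∸1∸-bounds {M} {a} 2≤M a≤ =
  trans (cong (_+ suc a) (∸-+-assoc M 1 a)) (m∸n+n≡m (<⇒≤ 1+a<M)) ,
  subst (1 ≤_) (sym (∸-+-assoc M 1 a)) (m<n⇒0<n∸m 1+a<M)
  where
  1+a<M : suc a < M
  1+a<M = ≤-trans (≤-reflexive (+-comm 2 a)) (m≤o∸n⇒m+n≤o a 2≤M a≤)

corollary3p4 :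
  (∀ (m n : ℕ) .{{_ : NonZero m}} .{{_ : NonZero n}} (a : ℕ) →
     1 ≤ a → a ≤ m + n ∸ 2 →
     ∀ (D : ZeroSet) →
       IsDual m n (T a ⊓ R n m) D ⇔ (pts D ≐ pts (T (m + n ∸ 1 ∸ a) ⊓ R n m)))
  ×
  (∀ (n : ℕ) .{{_ : NonZero n}} (a : ℕ) →
     1 ≤ a → a ≤ 2 * n ∸ 2 →
     let k = 2 * n ∸ 1 ∸ a
         instance d≢0 = k<2n⇒nonZero {k} {n} (2n∸1∸a<2n n a)
     in
     ∃[ e ] ∃[ g ]
       IsEx n n (StarsOfSize a) e
       × Isγ (T k) n n g
       × + e ≡ + (n * n) - + g
       × (2 ∣ k → g ≡ k * n / 2)
       × (2 ∤ k → k ≤ n → g ≡ (k + 1) / 2 * n ∸ (k ∸ 1) / 2)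
       × (2 ∤ k → n < k →
            g ≡ (k ∸ 1) / 2 * n + ⌈ n * (2 * n ∸ k + 1) / (2 * (2 * n ∸ k)) ⌉))
corollary3p4 = duality , extremal-number
  where
  duality : ∀ (m n : ℕ) .{{_ : NonZero m}} .{{_ : NonZero n}} (a : ℕ) →
    1 ≤ a → a ≤ m + n ∸ 2 →
    ∀ (D : ZeroSet) →
    IsDual m n (T a ⊓ R n m) D ⇔ (pts D ≐ pts (T (m + n ∸ 1 ∸ a) ⊓ R n m))
  duality m@(suc m-1) n@(suc n-1) a 1≤a a≤ =
    let sum≡ , 1≤b = ∸1∸-bounds (s≤s (≤-trans (s≤s z≤n) (m≤n+m n m-1))) a≤
    in dual⇔triangle 1≤a 1≤b (trans (rearrange a (m + n ∸ 1 ∸ a)) sum≡)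
    where
    rearrange : ∀ a b → a + b + 1 ≡ b + suc a
    rearrange = solve-∀

  extremal-number : ∀ (n : ℕ) .{{_ : NonZero n}} (a : ℕ) → 1 ≤ a → a ≤ 2 * n ∸ 2 →
    Conclusion n a (2 * n ∸ 1 ∸ a) {{k<2n⇒nonZero {2 * n ∸ 1 ∸ a} {n} (2n∸1∸a<2n n a)}}
  extremal-number n@(suc n-1) a _ a≤ =
    let k+D , 1≤k = ∸1∸-bounds (*-monoʳ-≤ 2 (s≤s (z≤n {n-1}))) a≤
    in conclude n a (2 * n ∸ 1 ∸ a) {{k<2n⇒nonZero {2 * n ∸ 1 ∸ a} {n} (2n∸1∸a<2n n a)}} k+D 1≤k
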